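{- Let $\mathcal F[\sigma]$ be a fragment of logic equivalent to a local variety of finite monoids $\mathbf V$. Let $L\subseteq A^*$ be a regular language and let $s$ be its stability index. Then the following statements are equivalent: (1) $L$ belongs to $\mathcal F[\sigma,\mathrm{MOD}]$; (2) $L$ belongs to $\mathcal F[\sigma,\mathrm{MOD}^s]$; (3) the stable monoid of $L$ belongs to $\mathbf V$. Furthermore, if $\mathcal F[\sigma]$ is decidable, then so is $\mathcal F[\sigma,\mathrm{MOD}]$.
   Context: Logic. A word $u$ over a finite alphabet $A$ is a set of positions $0,\dots,|u|-1$ labelled by letters. Formulas are monadic second order formulas over words; a signature $\sigma$ is a set of numerical predicates, and letter predicates $\mathbf a(x)$ (position $x$ carries letter $a$) are always available, for letters of any finite alphabet. A fragment of logic $\mathcal F[\sigma]$ is a set of closed formulas of $\mathrm{MSO}[\sigma]$ that contains the quantifier-free formulas and is closed under conjunction, disjunction and quantifier-free substitution (if $\varphi\in\mathcal F[\sigma]$ and $\psi(x_1,\dots,x_n)$ is a quantifier-free subformula of $\varphi$, then replacing $\psi$ by another quantifier-free formula over $\sigma$ with the same set of free variables gives a formula of $\mathcal F[\sigma]$). For a class of predicates $\sigma'$, the enrichment $\mathcal F[\sigma,\sigma']$ is the closure of $\mathcal F[\sigma]$ under quantifier-free substitutions with predicates ranging over $\sigma\cup\sigma'$. $\mathcal F[\sigma]$ also denotes the class of languages defined by its formulas (over each finite alphabet). For $d\ge 1$, $\mathrm{MOD}^d$ consists of, for $0\le i<d$, the unary predicates $\mathbf{MOD}_i^d(x)$ (position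 $x$ is congruent to $i$ mod $d$) and the constants $\mathbf D_i^d$ (the length of the word is congruent to $i$ mod $d$); $\mathrm{MOD}=\bigcup_{d\ge1}\mathrm{MOD}^d$. A fragment is decidable if, given a regular language, one can decide whether it is definable by a formula of the fragment. Algebra. A variety of monoids is a nonempty class of finite monoids closed under division (quotients of submonoids) and finite direct products. $\mathcal F[\sigma]$ is equivalent to $\mathbf V$ if the languages definable in $\mathcal F[\sigma]$ are exactly those recognized by a monoid of $\mathbf V$. For a morphism $\varphi:A^*\to M$ to a finite monoid, the stability index is the least positive integer $s$ with $\varphi(A^s)=\varphi(A^{2s})$, and the stable monoid is $\varphi((A^s)^*)$. The stability index and stable monoid of a regular language are those of its syntactic morphism. Categories. Categories are finite; a monoid is a one-object category. A division of categories $\tau:C\to D$ is a map on objects together with, for each pair of objects $e,f$ of $C$, a relation $\tau:C(e,f)\to D(\tau(e),\tau(f))$ such that $\tau(x)\tau(y)\subseteq\tau(xy)$ for consecutive arrows $x,y$; $\tau(x)\ne\emptyset$ for every arrow $x$; $1_{\tau(e)}\in\tau(1_e)$ for every object $e$; and $\tau(x)\cap\tau(y)=\emptyset$ for distinct coterminal arrows $x,y$ (same source and same target). $\mathbf{gV}$ is the class of all categories dividing a monoid of $\mathbf V$. $\ell\mathbf V$ is the class of all categories whose local monoids (the monoids $C(x,x)$, $x$ an object) are all in $\mathbf V$. $\mathbf V$ is local if $\mathbf{gV}=\ell\mathbf V$. -}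

module Defs where

open import Level using (Level; 0ℓ; _⊔_) renaming (suc to lsuc)
open import Algebra.Bundles using (Monoid)
open import Algebra.Construct.DirectProduct using () renaming (monoid to _×ᴹ_)
open import Algebra.Morphism.Structures
  using (IsMonoidHomomorphism; IsMonoidMonomorphism)
open import Data.Bool using (Bool; T)
open import Data.Empty using (⊥)
open import Data.Fin using (Fin; toℕ) renaming (suc to fsuc)
open import Data.Fin.Subset using (Subset) renaming (_∈_ to _∈ˢ_)
open import Data.List using (List; []; _++_; length; lookup; concat)
import Data.List.Properties as List
open import Data.List.Relation.Unary.All using (All; [])
import Data.List.Relation.Unary.All.Properties as All
open import Data.Nat using (ℕ; suc; _*_; _≤_; _≡ᵇ_; NonZero)
open import Data.Nat.DivMod using (_%_)
open import Data.Product using (Σ; Σ-syntax; ∃; ∃-syntax; _×_; _,_; proj₁; proj₂)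
open import Data.Sum using (_⊎_)
open import Data.Unit using (⊤)
open import Data.Vec using (Vec; []; _∷_; map; head) renaming (lookup to _‼_)
open import Data.Vec.Membership.Propositional using () renaming (_∈_ to _∈ⱽ_)
open import Function using (id; _∘_)
open import Function.Bundles using (Inverse; _⇔_; mk⇔; module Equivalence)
open import Function.Definitions using (Surjective)
open import Relation.Binary using (Setoid; IsEquivalence; _Respects_)
open import Relation.Binary.PropositionalEquality
  using (_≡_; refl; sym; trans; cong; cong₂; subst; subst₂; setoid)
open import Relation.Nullary using (¬_; Dec)
open import Relation.Unary using (Pred; Decidable; _∪_; _≐_)

private variable
  ℓ ℓ₁ ℓ₂ : Level
  m k n : ℕ

-- A finite alphabet with n letters is Fin n.
Word : ℕ → Set
Word n = List (Fin n)

Language : ℕ → Set₁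
Language n = Pred (Word n) 0ℓ

LanguageClass : (ℓ : Level) → Set (lsuc ℓ ⊔ lsuc 0ℓ)
LanguageClass ℓ = ∀ {n} → Pred (Language n) ℓ

-- For each length n, a relation on the positions 0, …, n-1; it is
-- Bool-valued so that satisfaction in a word is decidable.  Arity 0 gives
-- constants depending only on n.
record NumPred : Set where
  field
    arity : ℕ
    holds : (n : ℕ) → Vec (Fin n) arity → Bool

open NumPred public

Signature : Set₁
Signature = Pred NumPred 0ℓ

-- Formula m k: m free first-order and k free set variables (de Bruijn).
-- Letters are named by natural numbers, so that a formula may mention
-- letters of any finite alphabet.
data Formula (m k : ℕ) : Set where
  true false  : Formula m k
  letter      : ℕ → Fin m → Formula m k
  num         : (P : NumPred) → Vec (Fin m) (arity P) → Formula m k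
  _∈∈_        : Fin m → Fin k → Formula m k
  ~_          : Formula m k → Formula m k
  _∧_ _∨_     : Formula m k → Formula m k → Formula m k
  ∃₁_ ∀₁_     : Formula (suc m) k → Formula m k
  ∃₂_ ∀₂_     : Formula m (suc k) → Formula m k

Sentence : Set
Sentence = Formula 0 0

module _ (u : Word n) where

  Sat : Vec (Fin (length u)) m → Vec (Subset (length u)) k → Formula m k → Set
  Sat ρ η true         = ⊤
  Sat ρ η false        = ⊥
  Sat ρ η (letter a x) = toℕ (lookup u (ρ ‼ x)) ≡ a
  Sat ρ η (num P xs)   = T (holds P (length u) (map (ρ ‼_) xs))
  Sat ρ η (x ∈∈ X)     = (ρ ‼ x) ∈ˢ (η ‼ X)
  Sat ρ η (~ φ)        = ¬ Sat ρ η φ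
  Sat ρ η (φ ∧ ψ)      = Sat ρ η φ × Sat ρ η ψ
  Sat ρ η (φ ∨ ψ)      = Sat ρ η φ ⊎ Sat ρ η ψ
  Sat ρ η (∃₁ φ)       = ∃[ p ] Sat (p ∷ ρ) η φ
  Sat ρ η (∀₁ φ)       = ∀ p → Sat (p ∷ ρ) η φ
  Sat ρ η (∃₂ φ)       = ∃[ X ] Sat ρ (X ∷ η) φ
  Sat ρ η (∀₂ φ)       = ∀ X → Sat ρ (X ∷ η) φ

_⊨_ : Word n → Sentence → Set
u ⊨ φ = Sat u [] [] φ

Defines : Sentence → Language n → Set
Defines φ L = ∀ u → L u ⇔ u ⊨ φ

QuantifierFree : Formula m k → Set
QuantifierFree (~ φ)   = QuantifierFree φ
QuantifierFree (φ ∧ ψ) = QuantifierFree φ × QuantifierFree ψ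
QuantifierFree (φ ∨ ψ) = QuantifierFree φ × QuantifierFree ψ
QuantifierFree (∃₁ φ)  = ⊥
QuantifierFree (∀₁ φ)  = ⊥
QuantifierFree (∃₂ φ)  = ⊥
QuantifierFree (∀₂ φ)  = ⊥
QuantifierFree _       = ⊤

-- φ ∈MSO[ σ ]: every numerical predicate of φ belongs to σ.
_∈MSO[_] : Formula m k → Signature → Set
(num P xs) ∈MSO[ σ ] = σ P
(~ φ)      ∈MSO[ σ ] = φ ∈MSO[ σ ]
(φ ∧ ψ)    ∈MSO[ σ ] = φ ∈MSO[ σ ] × ψ ∈MSO[ σ ]
(φ ∨ ψ)    ∈MSO[ σ ] = φ ∈MSO[ σ ] × ψ ∈MSO[ σ ]
(∃₁ φ)     ∈MSO[ σ ] = φ ∈MSO[ σ ]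
(∀₁ φ)     ∈MSO[ σ ] = φ ∈MSO[ σ ]
(∃₂ φ)     ∈MSO[ σ ] = φ ∈MSO[ σ ]
(∀₂ φ)     ∈MSO[ σ ] = φ ∈MSO[ σ ]
_          ∈MSO[ σ ] = ⊤

_∈FV₁_ : Fin m → Formula m k → Set
x ∈FV₁ true       = ⊥
x ∈FV₁ false      = ⊥
x ∈FV₁ letter a y = x ≡ y
x ∈FV₁ num P ys   = x ∈ⱽ ys
x ∈FV₁ (y ∈∈ Y)   = x ≡ y
x ∈FV₁ (~ φ)      = x ∈FV₁ φ
x ∈FV₁ (φ ∧ ψ)    = x ∈FV₁ φ ⊎ x ∈FV₁ ψ
x ∈FV₁ (φ ∨ ψ)    = x ∈FV₁ φ ⊎ x ∈FV₁ ψ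
x ∈FV₁ (∃₁ φ)     = fsuc x ∈FV₁ φ
x ∈FV₁ (∀₁ φ)     = fsuc x ∈FV₁ φ
x ∈FV₁ (∃₂ φ)     = x ∈FV₁ φ
x ∈FV₁ (∀₂ φ)     = x ∈FV₁ φ

_∈FV₂_ : Fin k → Formula m k → Set
X ∈FV₂ true       = ⊥
X ∈FV₂ false      = ⊥
X ∈FV₂ letter a y = ⊥
X ∈FV₂ num P ys   = ⊥
X ∈FV₂ (y ∈∈ Y)   = X ≡ Y
X ∈FV₂ (~ φ)      = X ∈FV₂ φ
X ∈FV₂ (φ ∧ ψ)    = X ∈FV₂ φ ⊎ X ∈FV₂ ψ
X ∈FV₂ (φ ∨ ψ)    = X ∈FV₂ φ ⊎ X ∈FV₂ ψ
X ∈FV₂ (∃₁ φ)     = X ∈FV₂ φ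
X ∈FV₂ (∀₁ φ)     = X ∈FV₂ φ
X ∈FV₂ (∃₂ φ)     = fsuc X ∈FV₂ φ
X ∈FV₂ (∀₂ φ)     = fsuc X ∈FV₂ φ

SameFV : Formula m k → Formula m k → Set
SameFV φ ψ = (∀ x → x ∈FV₁ φ ⇔ x ∈FV₁ ψ) × (∀ X → X ∈FV₂ φ ⇔ X ∈FV₂ ψ)

-- φ ⟶[ σ ] φ′: φ′ arises from φ by replacing one occurrence of a
-- quantifier-free subformula by a quantifier-free formula over σ with the
-- same free variables.
data _⟶[_]_ {m k} : Formula m k → Signature → Formula m k → Set₁ where
  here : ∀ {σ ψ ψ′} → QuantifierFree ψ → QuantifierFree ψ′ → ψ′ ∈MSO[ σ ] →
         SameFV ψ ψ′ → ψ ⟶[ σ ] ψ′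
  ~_   : ∀ {σ φ φ′} → φ ⟶[ σ ] φ′ → (~ φ) ⟶[ σ ] (~ φ′)
  ∧ˡ   : ∀ {σ φ φ′ ψ} → φ ⟶[ σ ] φ′ → (φ ∧ ψ) ⟶[ σ ] (φ′ ∧ ψ)
  ∧ʳ   : ∀ {σ φ ψ ψ′} → ψ ⟶[ σ ] ψ′ → (φ ∧ ψ) ⟶[ σ ] (φ ∧ ψ′)
  ∨ˡ   : ∀ {σ φ φ′ ψ} → φ ⟶[ σ ] φ′ → (φ ∨ ψ) ⟶[ σ ] (φ′ ∨ ψ)
  ∨ʳ   : ∀ {σ φ ψ ψ′} → ψ ⟶[ σ ] ψ′ → (φ ∨ ψ) ⟶[ σ ] (φ ∨ ψ′)
  ∃₁_  : ∀ {σ φ φ′} → φ ⟶[ σ ] φ′ → (∃₁ φ) ⟶[ σ ] (∃₁ φ′)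
  ∀₁_  : ∀ {σ φ φ′} → φ ⟶[ σ ] φ′ → (∀₁ φ) ⟶[ σ ] (∀₁ φ′)
  ∃₂_  : ∀ {σ φ φ′} → φ ⟶[ σ ] φ′ → (∃₂ φ) ⟶[ σ ] (∃₂ φ′)
  ∀₂_  : ∀ {σ φ φ′} → φ ⟶[ σ ] φ′ → (∀₂ φ) ⟶[ σ ] (∀₂ φ′)

record Fragment (σ : Signature) (ℓ : Level) : Set (lsuc ℓ ⊔ lsuc 0ℓ) where
  field
    member         : Pred Sentence ℓ
    member⇒MSO     : ∀ {φ} → member φ → φ ∈MSO[ σ ]
    quantifierFree : ∀ {φ} → QuantifierFree φ → φ ∈MSO[ σ ] → member φ
    conjunction    : ∀ {φ ψ} → member φ → member ψ → member (φ ∧ ψ)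
    disjunction    : ∀ {φ ψ} → member φ → member ψ → member (φ ∨ ψ)
    substitution   : ∀ {φ φ′} → member φ → φ ⟶[ σ ] φ′ → member φ′

data Enrichment {σ} (F : Fragment σ ℓ) (σ′ : Signature) :
                Sentence → Set (lsuc 0ℓ ⊔ ℓ) where
  base         : ∀ {φ} → Fragment.member F φ → Enrichment F σ′ φ
  substitution : ∀ {φ φ′} → Enrichment F σ′ φ → φ ⟶[ σ ∪ σ′ ] φ′ → Enrichment F σ′ φ′

DefinableIn : Pred Sentence ℓ → LanguageClass ℓ
DefinableIn Φ L = ∃[ φ ] Φ φ × Defines φ L

⟦_⟧ : ∀ {σ} → Fragment σ ℓ → LanguageClass ℓ
⟦ F ⟧ = DefinableIn (Fragment.member F)

⟦_,_⟧ : ∀ {σ} → Fragment σ ℓ → Signature → LanguageClass (lsuc 0ℓ ⊔ ℓ)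
⟦ F , σ′ ⟧ = DefinableIn (Enrichment F σ′)

modPosition : (d : ℕ) .{{_ : NonZero d}} → Fin d → NumPred
modPosition d i = record
  { arity = 1
  ; holds = λ n xs → (toℕ (head xs) % d) ≡ᵇ toℕ i
  }

modLength : (d : ℕ) .{{_ : NonZero d}} → Fin d → NumPred
modLength d i = record
  { arity = 0
  ; holds = λ n _ → (n % d) ≡ᵇ toℕ i
  }

MOD^ : (d : ℕ) .{{_ : NonZero d}} → Signature
MOD^ d P = ∃[ i ] (P ≡ modPosition d i ⊎ P ≡ modLength d i)

MOD : Signature
MOD P = ∃[ d ] Σ[ nz ∈ NonZero d ] MOD^ d {{nz}} P

Finite : Setoid 0ℓ 0ℓ → Set
Finite S = ∃[ n ] Inverse S (setoid (Fin n))

Mon : Set₁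
Mon = Monoid 0ℓ 0ℓ

FiniteMonoid : Mon → Set
FiniteMonoid M = Finite (Monoid.setoid M)

-- N divides M: N is a quotient of a submonoid (here S, embedded by ι) of M.
record _≼_ (N M : Mon) : Set₁ where
  private
    module N = Monoid N
    module M = Monoid M
  field
    S            : Mon
  private
    module S = Monoid S
  field
    ι            : S.Carrier → M.Carrier
    ι-embedding  : IsMonoidMonomorphism S.rawMonoid M.rawMonoid ι
    π            : S.Carrier → N.Carrier
    π-morphism   : IsMonoidHomomorphism S.rawMonoid N.rawMonoid π
    π-surjective : Surjective S._≈_ N._≈_ π

-- The trivial monoid (the empty product) divides every monoid, so binary
-- products give all finite products.
record Variety (ℓ : Level) : Set (lsuc (lsuc 0ℓ ⊔ ℓ)) where
  field
    member   : Pred Mon ℓ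
    finite   : ∀ {M} → member M → FiniteMonoid M
    nonempty : ∃[ M ] member M
    division : ∀ {M N} → member M → FiniteMonoid N → N ≼ M → member N
    product  : ∀ {M N} → member M → member N → member (M ×ᴹ N)

record Morphism (n : ℕ) (M : Mon) : Set where
  open Monoid M
  field
    apply          : Word n → Carrier
    isHomomorphism : IsMonoidHomomorphism
                       (Monoid.rawMonoid (List.++-monoid (Fin n))) rawMonoid apply

open Morphism public

record Recognizes (M : Mon) (L : Language n) : Set₁ where
  open Monoid M
  field
    morphism  : Morphism n M
    accept    : Pred Carrier 0ℓ
    accept?   : Decidable accept
    accept-≈  : accept Respects _≈_
    preimage  : ∀ u → L u ⇔ accept (apply morphism u)

Regular : Language n → Set₁
Regular L = ∃[ M ] FiniteMonoid M × Recognizes M L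

-- The decision procedure receives L through the finite monoid, morphism and
-- accepting set contained in the proof of regularity.
DecidableClass : LanguageClass ℓ → Set (lsuc 0ℓ ⊔ ℓ)
DecidableClass 𝓛 = ∀ {n} (L : Language n) → Regular L → Dec (𝓛 L)

EquivalentTo : ∀ {σ} → Fragment σ ℓ₁ → Variety ℓ₂ → Set (lsuc 0ℓ ⊔ ℓ₁ ⊔ ℓ₂)
EquivalentTo F V = ∀ {n} (L : Language n) →
  ⟦ F ⟧ L ⇔ (∃[ M ] Variety.member V M × Recognizes M L)

SyntacticCongruence : Language n → Word n → Word n → Set
SyntacticCongruence L u v = ∀ x y → L (x ++ u ++ y) ⇔ L (x ++ v ++ y)

private
  module _ (L : Language n) where
    open Equivalence

    synRefl : ∀ {u} → SyntacticCongruence L u u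
    synRefl x y = mk⇔ id id

    synSym : ∀ {u v} → SyntacticCongruence L u v → SyntacticCongruence L v u
    synSym p x y = mk⇔ (from (p x y)) (to (p x y))

    synTrans : ∀ {u v w} → SyntacticCongruence L u v → SyntacticCongruence L v w →
               SyntacticCongruence L u w
    synTrans p q x y = mk⇔ (to (q x y) ∘ to (p x y)) (from (p x y) ∘ from (q x y))

    synReflexive : ∀ {u v} → u ≡ v → SyntacticCongruence L u v
    synReflexive refl = synRefl

    synContext : ∀ {u v} → SyntacticCongruence L u v →
                 ∀ a b → SyntacticCongruence L (a ++ u ++ b) (a ++ v ++ b)
    synContext {u} {v} p a b x y =
      mk⇔ (subst L (shift v) ∘ to (p (x ++ a) (b ++ y)) ∘ subst L (sym (shift u)))
          (subst L (shift u) ∘ from (p (x ++ a) (b ++ y)) ∘ subst L (sym (shift v)))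
      where
      shift : ∀ w → (x ++ a) ++ w ++ b ++ y ≡ x ++ (a ++ w ++ b) ++ y
      shift w = trans (List.++-assoc x a _)
        (cong (x ++_) (sym (trans (List.++-assoc a (w ++ b) y)
                                  (cong (a ++_) (List.++-assoc w b y)))))

    synCong : ∀ {u u′ v v′} → SyntacticCongruence L u u′ → SyntacticCongruence L v v′ →
              SyntacticCongruence L (u ++ v) (u′ ++ v′)
    synCong {u} {u′} {v} {v′} p q = synTrans (synContext p [] v)
      (subst₂ (SyntacticCongruence L)
        (cong (u′ ++_) (List.++-identityʳ v)) (cong (u′ ++_) (List.++-identityʳ v′))
        (synContext q u′ []))

-- The quotient of A* by the syntactic congruence: words, with that
-- congruence as equality.
syntacticMonoid : Language n → Mon
syntacticMonoid {n} L = record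
  { Carrier  = Word n
  ; _≈_      = SyntacticCongruence L
  ; _∙_      = _++_
  ; ε        = []
  ; isMonoid = record
    { isSemigroup = record
      { isMagma = record
        { isEquivalence = record
          { refl  = λ {u} → synRefl L {u}
          ; sym   = λ {u} {v} → synSym L {u} {v}
          ; trans = λ {u} {v} {w} → synTrans L {u} {v} {w}
          }
        ; ∙-cong = λ {u} {u′} {v} {v′} → synCong L {u} {u′} {v} {v′}
        }
      ; assoc = λ u v w → synReflexive L (List.++-assoc u v w)
      }
    ; identity = (λ u → synRefl L {u})
               , (λ u → synReflexive L (List.++-identityʳ u))
    }
  }

syntacticMorphism : (L : Language n) → Morphism n (syntacticMonoid L)
syntacticMorphism L = record
  { apply          = id
  ; isHomomorphism = record
    { isMagmaHomomorphism = record
      { isRelHomomorphism = record { cong = synReflexive L }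
      ; homo              = λ u v → synRefl L {u ++ v}
      }
    ; ε-homo = synRefl L {[]}
    }
  }

-- A^ s is the set of words of length s.
A^ : ℕ → Language n
A^ s u = length u ≡ s

_⋆ : Language n → Language n
(K ⋆) u = ∃[ us ] All K us × concat us ≡ u

module _ {M : Mon} (φ : Morphism n M) where
  open Monoid M renaming (refl to ≈-refl; sym to ≈-sym; trans to ≈-trans)
  open IsMonoidHomomorphism (isHomomorphism φ) using (homo; ε-homo)

  Image : Language n → Pred Carrier 0ℓ
  Image K x = ∃[ u ] K u × apply φ u ≈ x

  Stable : ℕ → Set
  Stable s = Image (A^ s) ≐ Image (A^ (2 * s))

  record IsStabilityIndex (s : ℕ) : Set where
    field
      positive : NonZero s
      stable   : Stable s
      least    : ∀ t → NonZero t → Stable t → s ≤ t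

  private
    image-∙ : ∀ {K x y} → Image (K ⋆) x → Image (K ⋆) y → Image (K ⋆) (x ∙ y)
    image-∙ (u , (us , pu , eu) , hu) (v , (vs , pv , ev) , hv) =
      u ++ v ,
      (us ++ vs , All.++⁺ pu pv ,
       trans (sym (List.concat-++ us vs)) (cong₂ _++_ eu ev)) ,
      ≈-trans (homo u v) (∙-cong hu hv)

    image-ε : ∀ {K} → Image (K ⋆) ε
    image-ε = [] , ([] , [] , refl) , ε-homo

  -- φ((A^s)*) as a submonoid of M.
  stableMonoid : ℕ → Mon
  stableMonoid s = record
    { Carrier  = Σ Carrier (Image (A^ s ⋆))
    ; _≈_      = λ x y → proj₁ x ≈ proj₁ y
    ; _∙_      = λ { (x , p) (y , q) → x ∙ y , image-∙ p q }
    ; ε        = ε , image-ε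
    ; isMonoid = record
      { isSemigroup = record
        { isMagma = record
          { isEquivalence = record { refl = ≈-refl ; sym = ≈-sym ; trans = ≈-trans }
          ; ∙-cong        = ∙-cong
          }
        ; assoc = λ x y z → assoc (proj₁ x) (proj₁ y) (proj₁ z)
        }
      ; identity = (λ x → identityˡ (proj₁ x)) , (λ x → identityʳ (proj₁ x))
      }
    }

-- Composition is written in diagrammatic order.
record Category : Set₁ where
  infix  4 _≈_
  infixl 7 _∙_
  field
    Obj           : Set
    _⇒_           : Obj → Obj → Set
    _≈_           : ∀ {e f} → e ⇒ f → e ⇒ f → Set
    isEquivalence : ∀ {e f} → IsEquivalence (_≈_ {e} {f})
    1ᶜ            : ∀ e → e ⇒ e
    _∙_           : ∀ {e f g} → e ⇒ f → f ⇒ g → e ⇒ g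
    ∙-cong        : ∀ {e f g} {x x′ : e ⇒ f} {y y′ : f ⇒ g} →
                    x ≈ x′ → y ≈ y′ → x ∙ y ≈ x′ ∙ y′
    assoc         : ∀ {e f g h} (x : e ⇒ f) (y : f ⇒ g) (z : g ⇒ h) →
                    (x ∙ y) ∙ z ≈ x ∙ (y ∙ z)
    identityˡ     : ∀ {e f} (x : e ⇒ f) → 1ᶜ e ∙ x ≈ x
    identityʳ     : ∀ {e f} (x : e ⇒ f) → x ∙ 1ᶜ f ≈ x

  homSetoid : Obj → Obj → Setoid 0ℓ 0ℓ
  homSetoid e f = record { Carrier = e ⇒ f ; isEquivalence = isEquivalence }

  localMonoid : Obj → Mon
  localMonoid e = record
    { Carrier  = e ⇒ e
    ; isMonoid = record
      { isSemigroup = record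
        { isMagma = record { isEquivalence = isEquivalence ; ∙-cong = ∙-cong }
        ; assoc   = assoc
        }
      ; identity = identityˡ , identityʳ
      }
    }

FiniteCategory : Category → Set
FiniteCategory C = Finite (setoid Obj) × (∀ e f → Finite (homSetoid e f))
  where open Category C

oneObject : Mon → Category
oneObject M = record
  { Obj           = ⊤
  ; _⇒_           = λ _ _ → Carrier
  ; _≈_           = _≈_
  ; isEquivalence = isEquivalence
  ; 1ᶜ            = λ _ → ε
  ; _∙_           = _∙_
  ; ∙-cong        = ∙-cong
  ; assoc         = assoc
  ; identityˡ     = identityˡ
  ; identityʳ     = identityʳ
  }
  where open Monoid M

record CategoryDivision (C D : Category) : Set₁ where
  private
    module C = Category C
    module D = Category D
  field
    obj       : C.Obj → D.Obj
    τ         : ∀ {e f} → e C.⇒ f → obj e D.⇒ obj f → Set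
    τ-resp-≈  : ∀ {e f} {x x′ : e C.⇒ f} {y y′ : obj e D.⇒ obj f} →
                x C.≈ x′ → y D.≈ y′ → τ x y → τ x′ y′
    τ-∙       : ∀ {e f g} {x : e C.⇒ f} {x′ : f C.⇒ g} {y y′} →
                τ x y → τ x′ y′ → τ (x C.∙ x′) (y D.∙ y′)
    τ-total   : ∀ {e f} (x : e C.⇒ f) → ∃[ y ] τ x y
    τ-1       : ∀ e → τ (C.1ᶜ e) (D.1ᶜ (obj e))
    τ-disjoint : ∀ {e f} {x x′ : e C.⇒ f} → ¬ (x C.≈ x′) → ∀ {y} → τ x y → ¬ τ x′ y

module _ (V : Variety ℓ) where
  open Variety V

  _∈𝐠 : Category → Set (lsuc 0ℓ ⊔ ℓ)
  C ∈𝐠 = FiniteCategory C × ∃[ M ] member M × CategoryDivision C (oneObject M)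

  _∈ℓ : Category → Set ℓ
  C ∈ℓ = FiniteCategory C × (∀ e → member (Category.localMonoid C e))

  Local : Set (lsuc 0ℓ ⊔ ℓ)
  Local = ∀ C → C ∈𝐠 ⇔ C ∈ℓ

{-# OPTIONS --safe #-}

-- Marking every letter with its position modulo d turns the predicates of
-- MOD^d into letter predicates: L is definable in F[σ, MOD^d] iff there are
-- languages K r over A × ℤ/d, definable in F, such that u ∈ L iff the marked
-- version of u belongs to K r, where r is the length of u modulo d.
--
-- (1) ⇒ (3): take d to be a multiple of s.  On the words of length divisible
-- by d, marking from any fixed residue is a morphism; the product, over all
-- starting residues and all r, of the recognizing morphisms of the K r
-- determines the syntactic class, so the stable monoid, which by stability is
-- the image of (A^d)*, divides a finite product of monoids of V.
--
-- (3) ⇒ (2): the residues modulo s are the objects of a category whose arrows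
-- are the syntactic classes of words.  Its local monoids are copies of the
-- stable monoid, so by locality it divides a monoid M of V.  Choosing a value
-- in M for every marked letter gives a morphism on marked words which,
-- together with the length modulo s, determines the syntactic class.
--
-- Only stability of s is used, never minimality, so for decidability any
-- stable s will do; and a finite monoid N is in V iff the fibres of the
-- evaluation of words over N are definable in F.
module Submission where

open import Defs
open import Level using (Level; 0ℓ; _⊔_) renaming (suc to lsuc)
open import Algebra.Bundles using (Monoid)
open import Algebra.Morphism.Structures using (IsMonoidHomomorphism)
open import Data.Bool using (Bool; T; if_then_else_)
open import Data.Empty using (⊥; ⊥-elim)
open import Data.Fin using (Fin; toℕ; cast; combine; remQuot; funToFin; finToFun)
  renaming (zero to fzero; suc to fsuc)
import Data.Fin.Properties as Fin
open import Data.Fin.Properties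
  using ( subst-is-cast; toℕ-combine; toℕ-fromℕ<; toℕ<n; toℕ-injective; pigeonhole
        ; finToFun-funToFin; remQuot-combine; combine-injective)
  renaming (_≟_ to _≟F_)
open import Data.Fin.Subset using (Subset) renaming (_∈_ to _∈ˢ_)
open import Data.List
  using ( List; []; _∷_; _++_; length; lookup; concat; allFin; cartesianProductWith
        ; concatMap; deduplicate)
open import Data.List.Membership.Propositional using (_∈_; lose)
open import Data.List.Membership.Propositional.Properties
  using (∈-lookup; ∈-cartesianProductWith⁺; ∈-allFin)
open import Data.List.Properties using (length-++; ++-identityʳ; ++-assoc; ++-monoid)
open import Data.List.Relation.Unary.All as All using (All; []; _∷_; all?)
open import Data.List.Relation.Unary.AllPairs using (_∷_)
open import Data.List.Relation.Unary.Any as Any using (Any; any?; here; there; index; satisfied)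
open import Data.List.Relation.Unary.Any.Properties using (lookup-index; concatMap⁺)
open import Data.List.Relation.Unary.Enumerates.Setoid using (IsEnumeration)
open import Data.List.Relation.Unary.Enumerates.Setoid.Properties using (deduplicate⁺)
open import Data.List.Relation.Unary.Unique.DecSetoid.Properties using (deduplicate-!)
import Data.List.Relation.Unary.Unique.Setoid as Unique
open import Data.Nat
  using ( ℕ; zero; suc; _+_; _*_; _^_; _∸_; _/_; _≡ᵇ_; _≤_; _<_; s≤s; _<?_
        ; >-nonZero; ≢-nonZero⁻¹; NonZero)
open import Data.Nat.DivMod
  using ( _%_; _mod_; m*n/n≡m; m<n⇒m/n≡0; m≡m%n+[m/n]*n; m%n<n; m%n%n≡m%n; m<n⇒m%n≡m; n%n≡0
        ; m*n%n≡0; %-distribˡ-+; m∣n⇒o%n%m≡o%m; +-distrib-/-∣ˡ; [m+kn]%n≡m%n)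
open import Data.Nat.Divisibility
  using ( _∣_; divides; divides-refl; _∣?_; _∣0; ∣-refl; ∣-trans; m∣m*n; n∣m*n; m%n≡0⇒n∣m
        ; ∣m∣n⇒∣m+n; ∣m+n∣m⇒∣n)
open import Data.Nat.Properties
  using ( nonZero?; ≡ᵇ⇒≡; ≡⇒≡ᵇ; ≤-trans; <⇒≤; ≮⇒≥; n<1+n; n≤1+n; m<1+n⇒m<n∨m≡n; m<n⇒0<n∸m
        ; suc-injective; +-assoc; +-comm; +-identityʳ; +-monoʳ-<; m≤m+n; m+[n∸m]≡n
        ; *-comm; *-assoc; *-suc; *-distribʳ-+; m≤m*n; m*n≢0)
  renaming (_≟_ to _≟ℕ_)
open import Data.Product using (Σ; Σ-syntax; ∃; ∃-syntax; _×_; _,_; proj₁; proj₂)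
open import Data.Product.Function.NonDependent.Propositional using (_×-⇔_)
open import Data.Sum using (_⊎_; inj₁; inj₂)
open import Data.Sum.Function.Propositional using (_⊎-⇔_)
open import Data.Unit using (⊤; tt)
open import Data.Vec using (Vec; []; _∷_) renaming (lookup to _‼_; map to mapⱽ)
open import Data.Vec.Relation.Unary.Any using (here)
open import Function using (id; _∘_)
open import Function.Bundles using (_⇔_; mk⇔; module Equivalence; Inverse; Injection)
import Function.Construct.Composition as Compose
import Function.Construct.Identity as Identity
open import Function.Construct.Identity using (⇔-id)
open import Function.Construct.Symmetry using (⇔-sym)
open import Function.Properties.Inverse using (Inverse⇒Injection)
open import Function.Related.TypeIsomorphisms using (¬-cong-⇔)
open import Relation.Binary using (Setoid; DecSetoid; IsEquivalence; Rel; Decidable)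
open import Relation.Binary.Construct.Closure.ReflexiveTransitive
  using (Star; ε; _◅_; _◅◅_; gmap)
import Relation.Binary.Construct.On as On
open import Relation.Binary.PropositionalEquality hiding (decSetoid)
open import Relation.Nullary using (¬_; Dec; yes; no; recompute; contradiction)
open import Relation.Nullary.Decidable using (map′; _×-dec_; _→-dec_; does; decidable-stable)
open import Relation.Unary using (_∪_)
import Relation.Unary as Unary

open Equivalence using (to; from)

private variable
  ℓ ℓ₁ ℓ₂ : Level
  m k n : ℕ
  σ σ₁ σ₂ : Signature

-- Equivalences and satisfaction of formulas.

infixr 8 _⨾_

_⨾_ : {A : Set ℓ} {B : Set ℓ₁} {C : Set ℓ₂} → A ⇔ B → B ⇔ C → A ⇔ C
_⨾_ = Compose.equivalence

∃-⇔ : {A : Set} {P Q : A → Set} → (∀ x → P x ⇔ Q x) → (∃ P) ⇔ (∃ Q)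
∃-⇔ h = mk⇔ (λ (x , p) → x , to (h x) p) (λ (x , q) → x , from (h x) q)

∀-⇔ : {A : Set} {P Q : A → Set} → (∀ x → P x ⇔ Q x) → (∀ x → P x) ⇔ (∀ x → Q x)
∀-⇔ h = mk⇔ (λ p x → to (h x) (p x)) (λ q x → from (h x) (q x))

-- Sat with the length as a variable: a word and its marked version have only
-- propositionally equal lengths.
module _ {N : ℕ} (lab : Fin N → ℕ) where

  Holds : Vec (Fin N) m → Vec (Subset N) k → Formula m k → Set
  Holds ρ η true         = ⊤
  Holds ρ η false        = ⊥
  Holds ρ η (letter a x) = lab (ρ ‼ x) ≡ a
  Holds ρ η (num P xs)   = T (holds P N (mapⱽ (ρ ‼_) xs))
  Holds ρ η (x ∈∈ X)     = (ρ ‼ x) ∈ˢ (η ‼ X)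
  Holds ρ η (~ φ)        = ¬ Holds ρ η φ
  Holds ρ η (φ ∧ ψ)      = Holds ρ η φ × Holds ρ η ψ
  Holds ρ η (φ ∨ ψ)      = Holds ρ η φ ⊎ Holds ρ η ψ
  Holds ρ η (∃₁ φ)       = ∃[ p ] Holds (p ∷ ρ) η φ
  Holds ρ η (∀₁ φ)       = ∀ p → Holds (p ∷ ρ) η φ
  Holds ρ η (∃₂ φ)       = ∃[ X ] Holds ρ (X ∷ η) φ
  Holds ρ η (∀₂ φ)       = ∀ X → Holds ρ (X ∷ η) φ

labels : (u : Word n) → Fin (length u) → ℕ
labels u x = toℕ (lookup u x)

Sat⇔Holds : ∀ (u : Word n) ρ η (φ : Formula m k) → Sat u ρ η φ ⇔ Holds (labels u) ρ η φ
Sat⇔Holds u ρ η true         = ⇔-id _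
Sat⇔Holds u ρ η false        = ⇔-id _
Sat⇔Holds u ρ η (letter a x) = ⇔-id _
Sat⇔Holds u ρ η (num P xs)   = ⇔-id _
Sat⇔Holds u ρ η (x ∈∈ X)     = ⇔-id _
Sat⇔Holds u ρ η (~ φ)        = ¬-cong-⇔ (Sat⇔Holds u ρ η φ)
Sat⇔Holds u ρ η (φ ∧ ψ)      = Sat⇔Holds u ρ η φ ×-⇔ Sat⇔Holds u ρ η ψ
Sat⇔Holds u ρ η (φ ∨ ψ)      = Sat⇔Holds u ρ η φ ⊎-⇔ Sat⇔Holds u ρ η ψ
Sat⇔Holds u ρ η (∃₁ φ)       = ∃-⇔ λ p → Sat⇔Holds u (p ∷ ρ) η φ
Sat⇔Holds u ρ η (∀₁ φ)       = ∀-⇔ λ p → Sat⇔Holds u (p ∷ ρ) η φ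
Sat⇔Holds u ρ η (∃₂ φ)       = ∃-⇔ λ X → Sat⇔Holds u ρ (X ∷ η) φ
Sat⇔Holds u ρ η (∀₂ φ)       = ∀-⇔ λ X → Sat⇔Holds u ρ (X ∷ η) φ

-- Translating atoms by quantifier-free substitution.

record Replacement (σ : Signature) {m k} (ψ : Formula m k) : Set where
  field
    formula        : Formula m k
    quantifierFree : QuantifierFree formula
    inSignature    : formula ∈MSO[ σ ]
    sameFV         : SameFV ψ formula

open Replacement

-- Only letters and numerical predicates are replaced. Since each replacement keeps the free
-- variables, the whole translation can be carried out by substitution steps.
record Translation (σ₁ σ₂ : Signature) : Set₁ where
  field
    letterᵀ : ∀ {m k} a (x : Fin m) → Replacement σ₂ {m} {k} (letter a x)
    numᵀ    : ∀ {m k} P → σ₁ P → (xs : Vec (Fin m) (arity P)) →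
              Replacement σ₂ {m} {k} (num P xs)

sameFV-refl : (φ : Formula m k) → SameFV φ φ
sameFV-refl φ = (λ _ → ⇔-id _) , (λ _ → ⇔-id _)

_⟶[_]*_ : Formula m k → Signature → Formula m k → Set₁
φ ⟶[ σ ]* ψ = Star (λ φ ψ → φ ⟶[ σ ] ψ) φ ψ

module _ (τ : Translation σ₁ σ₂) where
  open Translation τ

  translate : (φ : Formula m k) → φ ∈MSO[ σ₁ ] → Formula m k
  translate true         _       = true
  translate false        _       = false
  translate (letter a x) _       = formula (letterᵀ a x)
  translate (num P xs)   p       = formula (numᵀ P p xs)
  translate (x ∈∈ X)     _       = x ∈∈ X
  translate (~ φ)        p       = ~ translate φ p
  translate (φ ∧ ψ)      (p , q) = translate φ p ∧ translate ψ q
  translate (φ ∨ ψ)      (p , q) = translate φ p ∨ translate ψ q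
  translate (∃₁ φ)       p       = ∃₁ translate φ p
  translate (∀₁ φ)       p       = ∀₁ translate φ p
  translate (∃₂ φ)       p       = ∃₂ translate φ p
  translate (∀₂ φ)       p       = ∀₂ translate φ p

  translate-replacement : (ψ : Formula m k) (p : ψ ∈MSO[ σ₁ ]) → QuantifierFree ψ →
    QuantifierFree (translate ψ p) × translate ψ p ∈MSO[ σ₂ ] × SameFV ψ (translate ψ p)
  translate-replacement true         p q = tt , tt , sameFV-refl true
  translate-replacement false        p q = tt , tt , sameFV-refl false
  translate-replacement (letter a x) p q =
    quantifierFree r , inSignature r , sameFV r where r = letterᵀ a x
  translate-replacement (num P xs)   p q =
    quantifierFree r , inSignature r , sameFV r where r = numᵀ P p xs
  translate-replacement (x ∈∈ X)     p q = tt , tt , sameFV-refl (x ∈∈ X)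
  translate-replacement (~ φ)        p q = translate-replacement φ p q
  translate-replacement (φ ∧ ψ) (p , p′) (q , q′)
    with translate-replacement φ p q | translate-replacement ψ p′ q′
  ... | a , b , (c , c′) | a′ , b′ , (e , e′) =
    (a , a′) , (b , b′) , (λ x → c x ⊎-⇔ e x) , (λ X → c′ X ⊎-⇔ e′ X)
  translate-replacement (φ ∨ ψ) (p , p′) (q , q′)
    with translate-replacement φ p q | translate-replacement ψ p′ q′
  ... | a , b , (c , c′) | a′ , b′ , (e , e′) =
    (a , a′) , (b , b′) , (λ x → c x ⊎-⇔ e x) , (λ X → c′ X ⊎-⇔ e′ X)

  -- Both sides of the replaced occurrence translate to quantifier-free formulas with unchanged free
  -- variables, so a single step over `σ₂` suffices. This lets a derivation in an enrichment be
  -- replayed inside the fragment.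
  translate-step : {φ φ′ : Formula m k} → φ ⟶[ σ₁ ] φ′ → (p : φ ∈MSO[ σ₁ ]) →
                   Σ[ p′ ∈ φ′ ∈MSO[ σ₁ ] ] translate φ p ⟶[ σ₂ ] translate φ′ p′
  translate-step (here {ψ = ψ} {ψ′} q q′ p′ fv) p
    with translate-replacement ψ p q | translate-replacement ψ′ p′ q′
  ... | a , _ , (c , d) | a′ , b′ , (c′ , d′) =
    p′ , here a a′ b′ ( (λ x → ⇔-sym (c x) ⨾ proj₁ fv x ⨾ c′ x)
                      , (λ X → ⇔-sym (d X) ⨾ proj₂ fv X ⨾ d′ X))
  translate-step (~ s)  p       = let p′ , s′ = translate-step s p in p′ , ~ s′
  translate-step (∧ˡ s) (p , q) = let p′ , s′ = translate-step s p in (p′ , q) , ∧ˡ s′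
  translate-step (∧ʳ s) (p , q) = let q′ , s′ = translate-step s q in (p , q′) , ∧ʳ s′
  translate-step (∨ˡ s) (p , q) = let p′ , s′ = translate-step s p in (p′ , q) , ∨ˡ s′
  translate-step (∨ʳ s) (p , q) = let q′ , s′ = translate-step s q in (p , q′) , ∨ʳ s′
  translate-step (∃₁ s) p       = let p′ , s′ = translate-step s p in p′ , ∃₁ s′
  translate-step (∀₁ s) p       = let p′ , s′ = translate-step s p in p′ , ∀₁ s′
  translate-step (∃₂ s) p       = let p′ , s′ = translate-step s p in p′ , ∃₂ s′
  translate-step (∀₂ s) p       = let p′ , s′ = translate-step s p in p′ , ∀₂ s′

  -- Atoms are quantifier-free, so they can be substituted one at a time, under any quantifiers.
  ⟶*-translate : (φ : Formula m k) (p : φ ∈MSO[ σ₁ ]) → φ ⟶[ σ₂ ]* translate φ p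
  ⟶*-translate true         p = ε
  ⟶*-translate false        p = ε
  ⟶*-translate (letter a x) p =
    here tt (quantifierFree r) (inSignature r) (sameFV r) ◅ ε where r = letterᵀ a x
  ⟶*-translate (num P xs)   p =
    here tt (quantifierFree r) (inSignature r) (sameFV r) ◅ ε where r = numᵀ P p xs
  ⟶*-translate (x ∈∈ X)     p = ε
  ⟶*-translate (~ φ)        p = gmap ~_ ~_ (⟶*-translate φ p)
  ⟶*-translate (φ ∧ ψ) (p , q) =
    gmap (_∧ _) ∧ˡ (⟶*-translate φ p) ◅◅ gmap (_ ∧_) ∧ʳ (⟶*-translate ψ q)
  ⟶*-translate (φ ∨ ψ) (p , q) =
    gmap (_∨ _) ∨ˡ (⟶*-translate φ p) ◅◅ gmap (_ ∨_) ∨ʳ (⟶*-translate ψ q)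
  ⟶*-translate (∃₁ φ)       p = gmap ∃₁_ ∃₁_ (⟶*-translate φ p)
  ⟶*-translate (∀₁ φ)       p = gmap ∀₁_ ∀₁_ (⟶*-translate φ p)
  ⟶*-translate (∃₂ φ)       p = gmap ∃₂_ ∃₂_ (⟶*-translate φ p)
  ⟶*-translate (∀₂ φ)       p = gmap ∀₂_ ∀₂_ (⟶*-translate φ p)

  module _ {N} (lab lab′ : Fin N → ℕ)
    (letter-⇔ : ∀ {m k} (ρ : Vec _ m) (η : Vec _ k) a x →
       (lab (ρ ‼ x) ≡ a) ⇔ Holds lab′ ρ η (formula (letterᵀ a x)))
    (num-⇔ : ∀ {m k} (ρ : Vec _ m) (η : Vec _ k) P p xs →
       T (holds P N (mapⱽ (ρ ‼_) xs)) ⇔ Holds lab′ ρ η (formula (numᵀ P p xs)))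
    where

    Holds-translate : ∀ ρ η (φ : Formula m k) p →
                      Holds lab ρ η φ ⇔ Holds lab′ ρ η (translate φ p)
    Holds-translate ρ η true         _       = ⇔-id _
    Holds-translate ρ η false        _       = ⇔-id _
    Holds-translate ρ η (letter a x) _       = letter-⇔ ρ η a x
    Holds-translate ρ η (num P xs)   p       = num-⇔ ρ η P p xs
    Holds-translate ρ η (x ∈∈ X)     _       = ⇔-id _
    Holds-translate ρ η (~ φ)        p       = ¬-cong-⇔ (Holds-translate ρ η φ p)
    Holds-translate ρ η (φ ∧ ψ)      (p , q) = Holds-translate ρ η φ p ×-⇔ Holds-translate ρ η ψ q
    Holds-translate ρ η (φ ∨ ψ)      (p , q) = Holds-translate ρ η φ p ⊎-⇔ Holds-translate ρ η ψ q
    Holds-translate ρ η (∃₁ φ)       p       = ∃-⇔ λ x → Holds-translate (x ∷ ρ) η φ p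
    Holds-translate ρ η (∀₁ φ)       p       = ∀-⇔ λ x → Holds-translate (x ∷ ρ) η φ p
    Holds-translate ρ η (∃₂ φ)       p       = ∃-⇔ λ X → Holds-translate ρ (X ∷ η) φ p
    Holds-translate ρ η (∀₂ φ)       p       = ∀-⇔ λ X → Holds-translate ρ (X ∷ η) φ p

-- Residues modulo `d` and marked words.

module _ {d} .{{_ : NonZero d}} where

  infixl 6 _⊕_

  _⊕_ : Fin d → ℕ → Fin d
  e ⊕ k = (toℕ e + k) mod d

  origin : Fin d
  origin = 0 mod d

  toℕ-⊕ : ∀ e k → toℕ (e ⊕ k) ≡ (toℕ e + k) % d
  toℕ-⊕ e k = toℕ-fromℕ< _

  [m%d+n]%d≡[m+n]%d : ∀ m n → (m % d + n) % d ≡ (m + n) % d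
  [m%d+n]%d≡[m+n]%d m n = begin
    (m % d + n) % d          ≡⟨ %-distribˡ-+ (m % d) n d ⟩
    (m % d % d + n % d) % d  ≡⟨ cong (λ z → (z + n % d) % d) (m%n%n≡m%n m d) ⟩
    (m % d + n % d) % d      ≡⟨ %-distribˡ-+ m n d ⟨
    (m + n) % d              ∎
    where open ≡-Reasoning

  ⊕-⊕ : ∀ e k l → e ⊕ k ⊕ l ≡ e ⊕ (k + l)
  ⊕-⊕ e k l = toℕ-injective (begin
    toℕ (e ⊕ k ⊕ l)            ≡⟨ toℕ-⊕ (e ⊕ k) l ⟩
    (toℕ (e ⊕ k) + l) % d      ≡⟨ cong (λ z → (z + l) % d) (toℕ-⊕ e k) ⟩
    ((toℕ e + k) % d + l) % d  ≡⟨ [m%d+n]%d≡[m+n]%d (toℕ e + k) l ⟩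
    (toℕ e + k + l) % d        ≡⟨ cong (_% d) (+-assoc (toℕ e) k l) ⟩
    (toℕ e + (k + l)) % d      ≡⟨ toℕ-⊕ e (k + l) ⟨
    toℕ (e ⊕ (k + l))          ∎)
    where open ≡-Reasoning

  ⊕-identityʳ : ∀ e → e ⊕ 0 ≡ e
  ⊕-identityʳ e = toℕ-injective (begin
    toℕ (e ⊕ 0)      ≡⟨ toℕ-⊕ e 0 ⟩
    (toℕ e + 0) % d  ≡⟨ cong (_% d) (+-identityʳ (toℕ e)) ⟩
    toℕ e % d        ≡⟨ m<n⇒m%n≡m (toℕ<n e) ⟩
    toℕ e            ∎)
    where open ≡-Reasoning

  toℕ-origin⊕ : ∀ k → toℕ (origin ⊕ k) ≡ k % d
  toℕ-origin⊕ k = begin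
    toℕ (origin ⊕ k)      ≡⟨ toℕ-⊕ origin k ⟩
    (toℕ origin + k) % d  ≡⟨ cong (λ z → (z + k) % d) (toℕ-fromℕ< _) ⟩
    (0 % d + k) % d       ≡⟨ [m%d+n]%d≡[m+n]%d 0 k ⟩
    k % d                 ∎
    where open ≡-Reasoning

  -- The letter a of u at position x becomes the pair (a , e + x mod d), coded
  -- as d * a + (e + x mod d).
  mark : Fin d → Word n → Word (n * d)
  mark e []      = []
  mark e (a ∷ u) = combine a e ∷ mark (e ⊕ 1) u

  mark-++ : ∀ e (u v : Word n) → mark e (u ++ v) ≡ mark e u ++ mark (e ⊕ length u) v
  mark-++ e []      v = cong (λ z → mark z v) (sym (⊕-identityʳ e))
  mark-++ e (a ∷ u) v = cong (combine a e ∷_) (trans (mark-++ (e ⊕ 1) u v)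
    (cong (λ z → mark (e ⊕ 1) u ++ mark z v) (⊕-⊕ e 1 (length u))))

  length-mark : ∀ e (u : Word n) → length (mark e u) ≡ length u
  length-mark e []      = refl
  length-mark e (a ∷ u) = cong suc (length-mark (e ⊕ 1) u)

  lookup-mark : ∀ e (u : Word n) x →
    lookup (mark e u) (cast (sym (length-mark e u)) x) ≡ combine (lookup u x) (e ⊕ toℕ x)
  lookup-mark e (a ∷ u) fzero    = cong (combine a) (sym (⊕-identityʳ e))
  lookup-mark e (a ∷ u) (fsuc x) = trans (lookup-mark (e ⊕ 1) u x)
    (cong (combine (lookup u x)) (⊕-⊕ e 1 (toℕ x)))

  -- The labels of the marked word are transported to the positions of `u`, so that formulas about
  -- either word are evaluated over the same position set.
  markedLabels : (u : Word n) → Fin (length u) → ℕ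
  markedLabels u = labels (mark origin u) ∘ subst Fin (sym (length-mark origin u))

  markedLabels-combine : ∀ (u : Word n) x →
    markedLabels u x ≡ toℕ (combine (lookup u x) (origin ⊕ toℕ x))
  markedLabels-combine u x = cong toℕ (trans
    (cong (lookup (mark origin u)) (subst-is-cast (sym (length-mark origin u)) x))
    (lookup-mark origin u x))

  toℕ-combine-/ : ∀ (a : Fin n) (e : Fin d) → toℕ (combine a e) / d ≡ toℕ a
  toℕ-combine-/ a e = begin
    toℕ (combine a e) / d            ≡⟨ cong (_/ d) (toℕ-combine a e) ⟩
    (d * toℕ a + toℕ e) / d          ≡⟨ +-distrib-/-∣ˡ (toℕ e) (m∣m*n (toℕ a)) ⟩
    (d * toℕ a) / d + toℕ e / d      ≡⟨ cong₂ _+_ (trans (cong (_/ d) (*-comm d (toℕ a)))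
                                          (m*n/n≡m (toℕ a) d)) (m<n⇒m/n≡0 (toℕ<n e)) ⟩
    toℕ a + 0                        ≡⟨ +-identityʳ (toℕ a) ⟩
    toℕ a                            ∎
    where open ≡-Reasoning

  toℕ-combine-% : ∀ (a : Fin n) (e : Fin d) → toℕ (combine a e) % d ≡ toℕ e
  toℕ-combine-% a e = begin
    toℕ (combine a e) % d        ≡⟨ cong (_% d) (toℕ-combine a e) ⟩
    (d * toℕ a + toℕ e) % d      ≡⟨ cong (_% d) (trans (+-comm (d * toℕ a) (toℕ e))
                                      (cong (toℕ e +_) (*-comm d (toℕ a)))) ⟩
    (toℕ e + toℕ a * d) % d      ≡⟨ [m+kn]%n≡m%n (toℕ e) (toℕ a) d ⟩
    toℕ e % d                    ≡⟨ m<n⇒m%n≡m (toℕ<n e) ⟩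
    toℕ e                        ∎
    where open ≡-Reasoning

  markedLabels-/ : ∀ (u : Word n) x → markedLabels u x / d ≡ labels u x
  markedLabels-/ u x = trans (cong (_/ d) (markedLabels-combine u x))
    (toℕ-combine-/ (lookup u x) (origin ⊕ toℕ x))

  markedLabels-% : ∀ (u : Word n) x → markedLabels u x % d ≡ toℕ x % d
  markedLabels-% u x = trans (cong (_% d) (markedLabels-combine u x))
    (trans (toℕ-combine-% (lookup u x) (origin ⊕ toℕ x)) (toℕ-origin⊕ (toℕ x)))

  Sat-mark⇔Holds : ∀ (u : Word n) φ → mark origin u ⊨ φ ⇔ Holds (markedLabels u) [] [] φ
  Sat-mark⇔Holds u φ = Sat⇔Holds (mark origin u) [] [] φ ⨾
    reindex (labels (mark origin u)) (sym (length-mark origin u))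
    where
    -- With the labelling and both lengths generalised to variables, the equation between the
    -- lengths can be matched with `refl`.
    reindex : ∀ {N N′} (lab : Fin N → ℕ) (eq : N′ ≡ N) →
              Holds lab [] [] φ ⇔ Holds (lab ∘ subst Fin eq) [] [] φ
    reindex lab refl = ⇔-id _

-- From marked letters to modular predicates.

trivialReplacement : {ψ : Formula m k} → QuantifierFree ψ → ψ ∈MSO[ σ ] → Replacement σ ψ
trivialReplacement {ψ = ψ} q p = record
  { formula = ψ ; quantifierFree = q ; inSignature = p ; sameFV = sameFV-refl ψ }

module _ {σ : Signature} (d : ℕ) .{{_ : NonZero d}} where

  -- The code `c` decodes as the letter `c / d` at a position congruent to `c mod d`.
  unmark : Translation σ (σ ∪ MOD^ d)
  unmark = record
    { letterᵀ = λ c x → record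
      { formula        = letter (c / d) x ∧ num (modPosition d (c mod d)) (x ∷ [])
      ; quantifierFree = tt , tt
      ; inSignature    = tt , inj₂ (c mod d , inj₁ refl)
      ; sameFV         = (λ y → mk⇔ inj₁ λ { (inj₁ e) → e ; (inj₂ (here e)) → e })
                       , (λ X → mk⇔ (λ ()) λ { (inj₁ ()) ; (inj₂ ()) })
      }
    ; numᵀ    = λ P p xs → trivialReplacement tt (inj₁ p)
    }

  unmark-⊨ : ∀ (u : Word n) φ p → mark origin u ⊨ φ ⇔ u ⊨ translate unmark φ p
  unmark-⊨ u φ p = Sat-mark⇔Holds u φ ⨾
    Holds-translate unmark (markedLabels u) (labels u)
      (λ ρ η c x → let y = ρ ‼ x in mk⇔
        (λ { refl → sym (markedLabels-/ u y) ,
               ≡⇒≡ᵇ _ _ (trans (sym (markedLabels-% u y)) (sym (toℕ-fromℕ< _))) })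
        (λ (q , r) → /-%-injective (trans (markedLabels-/ u y) q)
          (trans (markedLabels-% u y) (trans (≡ᵇ⇒≡ _ _ r) (toℕ-fromℕ< _)))))
      (λ ρ η P p xs → ⇔-id _)
      [] [] φ p ⨾
    ⇔-sym (Sat⇔Holds u [] [] (translate unmark φ p))
    where
    /-%-injective : ∀ {a b} → a / d ≡ b / d → a % d ≡ b % d → a ≡ b
    /-%-injective {a} {b} q r = trans (m≡m%n+[m/n]*n a d)
      (trans (cong₂ (λ x y → x + y * d) r q) (sym (m≡m%n+[m/n]*n b d)))

-- From modular predicates to marked letters.

constant : Bool → Formula m k
constant Bool.true  = true
constant Bool.false = false

constant-quantifierFree : ∀ b → QuantifierFree (constant {m} {k} b)
constant-quantifierFree Bool.true  = tt
constant-quantifierFree Bool.false = tt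

constant-∈MSO : ∀ b → constant {m} {k} b ∈MSO[ σ ]
constant-∈MSO Bool.true  = tt
constant-∈MSO Bool.false = tt

constant-FV₁ : ∀ b x → ¬ (x ∈FV₁ constant {m} {k} b)
constant-FV₁ Bool.true  x ()
constant-FV₁ Bool.false x ()

constant-FV₂ : ∀ b X → ¬ (X ∈FV₂ constant {m} {k} b)
constant-FV₂ Bool.true  X ()
constant-FV₂ Bool.false X ()

Holds-constant : ∀ {N} {lab : Fin N → ℕ} {ρ η} b → T b ⇔ Holds lab ρ η (constant {m} {k} b)
Holds-constant Bool.true  = ⇔-id _
Holds-constant Bool.false = ⇔-id _

-- The disjunction of the c(x) with c < N and b c; the conjunction with false
-- keeps x free.
someLetter : (ℕ → Bool) → ℕ → Fin m → Formula m k
someLetter b zero    x = letter 0 x ∧ false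
someLetter b (suc N) x = (letter N x ∧ constant (b N)) ∨ someLetter b N x

module _ (b : ℕ → Bool) where

  -- The comparison with `letter 0 x` merely says that `x` is the only free variable of `ψ`; thus
  -- one construction serves both letters and position predicates.
  someLetter-replacement : {ψ : Formula m k} {x : Fin m} (N : ℕ) → SameFV ψ (letter 0 x) →
                           Replacement σ ψ
  someLetter-replacement {x = x} N fv = record
    { formula        = someLetter b N x
    ; quantifierFree = qf N
    ; inSignature    = mso N
    ; sameFV         = (λ y → proj₁ fv y ⨾ mk⇔ (fv₁⁺ N) (fv₁⁻ N))
                     , (λ X → proj₂ fv X ⨾ mk⇔ (λ ()) (⊥-elim ∘ fv₂ N))
    }
    where
    qf : ∀ N → QuantifierFree (someLetter b N x)
    qf zero    = tt , tt
    qf (suc N) = (tt , constant-quantifierFree (b N)) , qf N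

    mso : ∀ N → someLetter b N x ∈MSO[ σ ]
    mso zero    = tt , tt
    mso (suc N) = (tt , constant-∈MSO (b N)) , mso N

    fv₁⁺ : ∀ {y} N → y ≡ x → y ∈FV₁ someLetter b N x
    fv₁⁺ zero    e = inj₁ e
    fv₁⁺ (suc N) e = inj₂ (fv₁⁺ N e)

    fv₁⁻ : ∀ {y} N → y ∈FV₁ someLetter b N x → y ≡ x
    fv₁⁻ zero    (inj₁ e)        = e
    fv₁⁻ (suc N) (inj₁ (inj₁ e)) = e
    fv₁⁻ (suc N) (inj₁ (inj₂ f)) = ⊥-elim (constant-FV₁ (b N) _ f)
    fv₁⁻ (suc N) (inj₂ f)        = fv₁⁻ N f

    fv₂ : ∀ {X} N → ¬ (X ∈FV₂ someLetter b N x)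
    fv₂ zero    (inj₁ ())
    fv₂ zero    (inj₂ ())
    fv₂ (suc N) (inj₁ (inj₂ f)) = constant-FV₂ (b N) _ f
    fv₂ (suc N) (inj₂ f)        = fv₂ N f

  Holds-someLetter : ∀ {M} {lab : Fin M → ℕ} (ρ : Vec _ m) (η : Vec _ k) N x → lab (ρ ‼ x) < N →
    T (b (lab (ρ ‼ x))) ⇔ Holds lab ρ η (someLetter b N x)
  Holds-someLetter {lab = lab} ρ η N x <N = mk⇔ (λ t → to′ N <N t) (from′ N)
    where
    to′ : ∀ N → lab (ρ ‼ x) < N → T (b (lab (ρ ‼ x))) → Holds lab ρ η (someLetter b N x)
    to′ (suc N) <1+N t with m<1+n⇒m<n∨m≡n <1+N
    ... | inj₁ <N   = inj₂ (to′ N <N t)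
    ... | inj₂ refl = inj₁ (refl , to (Holds-constant (b N)) t)

    from′ : ∀ N → Holds lab ρ η (someLetter b N x) → T (b (lab (ρ ‼ x)))
    from′ (suc N) (inj₁ (refl , h)) = from (Holds-constant (b N)) h
    from′ (suc N) (inj₂ h)          = from′ N h

-- Allowing all divisors of `d` makes the signature monotone along divisibility, so finitely many
-- moduli fit below a common multiple.
MOD∣ : ℕ → Signature
MOD∣ d P = ∃[ c ] Σ[ nz ∈ NonZero c ] c ∣ d × MOD^ c {{nz}} P

-- The length constants are evaluated for words of length r modulo d.
module _ {σ : Signature} (n d r : ℕ) .{{_ : NonZero d}} where

  toMarked : Translation (σ ∪ MOD∣ d) σ
  toMarked = record
    { letterᵀ = λ a x → someLetter-replacement (λ c → c / d ≡ᵇ a) (n * d)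
                          ((λ _ → ⇔-id _) , (λ _ → ⇔-id _))
    ; numᵀ    = num-replacement
    }
    where
    num-replacement : ∀ P → (σ ∪ MOD∣ d) P → (xs : Vec (Fin m) (arity P)) →
                      Replacement σ {m} {k} (num P xs)
    num-replacement P (inj₁ p) xs = trivialReplacement tt p
    num-replacement P (inj₂ (c , nz , _ , i , inj₁ refl)) (x ∷ []) =
      someLetter-replacement (λ l → _%_ (l % d) c {{nz}} ≡ᵇ toℕ i) (n * d)
        ( (λ y → mk⇔ (λ { (here e) → e }) here) , (λ _ → ⇔-id _))
    num-replacement P (inj₂ (c , nz , _ , i , inj₂ refl)) [] = let b = _%_ r c {{nz}} ≡ᵇ toℕ i in record
      { formula        = constant b
      ; quantifierFree = constant-quantifierFree b
      ; inSignature    = constant-∈MSO b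
      ; sameFV         = (λ x → mk⇔ (λ ()) (⊥-elim ∘ constant-FV₁ b x))
                       , (λ X → mk⇔ (λ ()) (⊥-elim ∘ constant-FV₂ b X))
      }

  -- For a divisor `c` of `d`, reduction modulo `d` does not change residues modulo `c`. Hence a
  -- marked label determines the residue of its position modulo `c`, and `r` determines that of the
  -- length.
  toMarked-⊨ : ∀ (u : Word n) φ p → length u % d ≡ r % d →
               u ⊨ φ ⇔ mark origin u ⊨ translate toMarked φ p
  toMarked-⊨ u φ p |u|≡r = Sat⇔Holds u [] [] φ ⨾
    Holds-translate toMarked (labels u) (markedLabels u) letter-⇔ num-⇔ [] [] φ p ⨾
    ⇔-sym (Sat-mark⇔Holds u (translate toMarked φ p))
    where
    ≡ᵇ-cong : ∀ {a b c} → a ≡ b → T (a ≡ᵇ c) ⇔ T (b ≡ᵇ c)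
    ≡ᵇ-cong refl = ⇔-id _

    <n*d : ∀ x → markedLabels u x < n * d
    <n*d x = toℕ<n _

    letter-⇔ : ∀ {m k} (ρ : Vec _ m) (η : Vec _ k) a x → (labels u (ρ ‼ x) ≡ a) ⇔
               Holds (markedLabels u) ρ η (someLetter (λ c → c / d ≡ᵇ a) (n * d) x)
    letter-⇔ ρ η a x = mk⇔ (≡⇒≡ᵇ _ _) (≡ᵇ⇒≡ _ _) ⨾
      ≡ᵇ-cong (sym (markedLabels-/ u (ρ ‼ x))) ⨾
      Holds-someLetter _ ρ η (n * d) x (<n*d (ρ ‼ x))

    num-⇔ : ∀ {m k} (ρ : Vec _ m) (η : Vec _ k) P p xs →
      T (holds P (length u) (mapⱽ (ρ ‼_) xs)) ⇔
      Holds (markedLabels u) ρ η (formula (Translation.numᵀ toMarked P p xs))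
    num-⇔ ρ η P (inj₁ p) xs = ⇔-id _
    num-⇔ ρ η P (inj₂ (c , nz , c∣d , i , inj₁ refl)) (x ∷ []) =
      ≡ᵇ-cong (trans (sym (m∣n⇒o%n%m≡o%m c d (toℕ (ρ ‼ x)) {{nz}} c∣d))
                     (cong (λ z → _%_ z c {{nz}}) (sym (markedLabels-% u (ρ ‼ x))))) ⨾
      Holds-someLetter _ ρ η (n * d) x (<n*d (ρ ‼ x))
    num-⇔ ρ η P (inj₂ (c , nz , c∣d , i , inj₂ refl)) [] =
      ≡ᵇ-cong (trans (sym (m∣n⇒o%n%m≡o%m c d (length u) {{nz}} c∣d))
                     (trans (cong (λ z → _%_ z c {{nz}}) |u|≡r) (m∣n⇒o%n%m≡o%m c d r {{nz}} c∣d))) ⨾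
      Holds-constant (_%_ r c {{nz}} ≡ᵇ toℕ i)

-- Monotonicity of enrichments and bounded moduli.

∈MSO-mono : (∀ {P} → σ₁ P → σ₂ P) → (φ : Formula m k) → φ ∈MSO[ σ₁ ] → φ ∈MSO[ σ₂ ]
∈MSO-mono f true         p       = tt
∈MSO-mono f false        p       = tt
∈MSO-mono f (letter a x) p       = tt
∈MSO-mono f (num P xs)   p       = f p
∈MSO-mono f (x ∈∈ X)     p       = tt
∈MSO-mono f (~ φ)        p       = ∈MSO-mono f φ p
∈MSO-mono f (φ ∧ ψ)      (p , q) = ∈MSO-mono f φ p , ∈MSO-mono f ψ q
∈MSO-mono f (φ ∨ ψ)      (p , q) = ∈MSO-mono f φ p , ∈MSO-mono f ψ q
∈MSO-mono f (∃₁ φ)       p       = ∈MSO-mono f φ p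
∈MSO-mono f (∀₁ φ)       p       = ∈MSO-mono f φ p
∈MSO-mono f (∃₂ φ)       p       = ∈MSO-mono f φ p
∈MSO-mono f (∀₂ φ)       p       = ∈MSO-mono f φ p

⟶-mono : (∀ {P} → σ₁ P → σ₂ P) → {φ φ′ : Formula m k} → φ ⟶[ σ₁ ] φ′ → φ ⟶[ σ₂ ] φ′
⟶-mono f (here {ψ′ = ψ′} q q′ p fv) = here q q′ (∈MSO-mono f ψ′ p) fv
⟶-mono f (~ s)  = ~ ⟶-mono f s
⟶-mono f (∧ˡ s) = ∧ˡ (⟶-mono f s)
⟶-mono f (∧ʳ s) = ∧ʳ (⟶-mono f s)
⟶-mono f (∨ˡ s) = ∨ˡ (⟶-mono f s)
⟶-mono f (∨ʳ s) = ∨ʳ (⟶-mono f s)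
⟶-mono f (∃₁ s) = ∃₁ ⟶-mono f s
⟶-mono f (∀₁ s) = ∀₁ ⟶-mono f s
⟶-mono f (∃₂ s) = ∃₂ ⟶-mono f s
⟶-mono f (∀₂ s) = ∀₂ ⟶-mono f s

enrichment-mono : {F : Fragment σ ℓ} → (∀ {P} → σ₁ P → σ₂ P) →
                  ∀ {φ} → Enrichment F σ₁ φ → Enrichment F σ₂ φ
enrichment-mono f (base p)           = base p
enrichment-mono f (substitution e s) =
  substitution (enrichment-mono f e) (⟶-mono (λ { (inj₁ p) → inj₁ p ; (inj₂ q) → inj₂ (f q) }) s)

enrichment-* : {F : Fragment σ ℓ} → ∀ {φ ψ} → Enrichment F σ₁ φ → φ ⟶[ σ ∪ σ₁ ]* ψ →
               Enrichment F σ₁ ψ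
enrichment-* e ε        = e
enrichment-* e (s ◅ ss) = enrichment-* (substitution e s) ss

member-* : (F : Fragment σ ℓ) → ∀ {φ ψ} → Fragment.member F φ → φ ⟶[ σ ]* ψ → Fragment.member F ψ
member-* F e ε        = e
member-* F e (s ◅ ss) = member-* F (Fragment.substitution F e s) ss

MOD^⇒MOD : ∀ d .{{_ : NonZero d}} {P} → MOD^ d P → MOD P
-- `MOD` stores a relevant proof that `d` is nonzero, which is recovered from the irrelevant
-- instance by decidability.
MOD^⇒MOD d {{nz}} p = d , recompute (nonZero? d) nz , p

MOD∣-mono : ∀ {c d} → c ∣ d → ∀ {P} → MOD∣ c P → MOD∣ d P
MOD∣-mono c∣d (b , nz , b∣c , p) = b , nz , ∣-trans b∣c c∣d , p

∪-MOD∣-mono : ∀ (σ : Signature) {c d} → c ∣ d → ∀ {P} → (σ ∪ MOD∣ c) P → (σ ∪ MOD∣ d) P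
∪-MOD∣-mono σ c∣d (inj₁ p) = inj₁ p
∪-MOD∣-mono σ c∣d (inj₂ p) = inj₂ (MOD∣-mono c∣d p)

BoundedModulus : ∀ {a} → (ℕ → Set a) → Set a
BoundedModulus A = ∃[ d ] NonZero d × A d

-- The product of the two moduli is a common multiple, to which monotonicity moves both witnesses.
commonModulus : ∀ {a b c} {A : ℕ → Set a} {B : ℕ → Set b} {C : ℕ → Set c} →
  (∀ {c d} → c ∣ d → A c → A d) → (∀ {c d} → c ∣ d → B c → B d) →
  (∀ {d} → A d → B d → C d) → BoundedModulus A → BoundedModulus B → BoundedModulus C
commonModulus monoA monoB f (c , nz , x) (d , nz′ , y) =
  c * d , m*n≢0 c d {{nz}} {{nz′}} , f (monoA (m∣m*n d) x) (monoB (n∣m*n c) y)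

mapModulus : ∀ {a b} {A : ℕ → Set a} {B : ℕ → Set b} →
             (∀ {d} → A d → B d) → BoundedModulus A → BoundedModulus B
mapModulus f (d , nz , x) = d , nz , f x

module _ {σ : Signature} where

  ∈MSO-modulus : (φ : Formula m k) → φ ∈MSO[ σ ∪ MOD ] →
                 BoundedModulus (λ d → φ ∈MSO[ σ ∪ MOD∣ d ])
  ∈MSO-modulus true         p        = 1 , _ , tt
  ∈MSO-modulus false        p        = 1 , _ , tt
  ∈MSO-modulus (letter a x) p        = 1 , _ , tt
  ∈MSO-modulus (num P xs)   (inj₁ p) = 1 , _ , inj₁ p
  ∈MSO-modulus (num P xs)   (inj₂ (d , nz , p)) = d , nz , inj₂ (d , nz , ∣-refl , p)
  ∈MSO-modulus (x ∈∈ X)     p        = 1 , _ , tt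
  ∈MSO-modulus (~ φ)        p        = ∈MSO-modulus φ p
  ∈MSO-modulus (φ ∧ ψ)      (p , q)  =
    commonModulus (λ e → ∈MSO-mono (∪-MOD∣-mono σ e) φ) (λ e → ∈MSO-mono (∪-MOD∣-mono σ e) ψ) _,_
      (∈MSO-modulus φ p) (∈MSO-modulus ψ q)
  ∈MSO-modulus (φ ∨ ψ)      (p , q)  =
    commonModulus (λ e → ∈MSO-mono (∪-MOD∣-mono σ e) φ) (λ e → ∈MSO-mono (∪-MOD∣-mono σ e) ψ) _,_
      (∈MSO-modulus φ p) (∈MSO-modulus ψ q)
  ∈MSO-modulus (∃₁ φ)       p        = ∈MSO-modulus φ p
  ∈MSO-modulus (∀₁ φ)       p        = ∈MSO-modulus φ p
  ∈MSO-modulus (∃₂ φ)       p        = ∈MSO-modulus φ p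
  ∈MSO-modulus (∀₂ φ)       p        = ∈MSO-modulus φ p

⟶-modulus : {φ φ′ : Formula m k} → φ ⟶[ σ ∪ MOD ] φ′ →
            BoundedModulus (λ d → φ ⟶[ σ ∪ MOD∣ d ] φ′)
⟶-modulus (here {ψ′ = ψ′} q q′ p fv) = mapModulus (λ p′ → here q q′ p′ fv) (∈MSO-modulus ψ′ p)
⟶-modulus (~ s)  = mapModulus ~_ (⟶-modulus s)
⟶-modulus (∧ˡ s) = mapModulus ∧ˡ (⟶-modulus s)
⟶-modulus (∧ʳ s) = mapModulus ∧ʳ (⟶-modulus s)
⟶-modulus (∨ˡ s) = mapModulus ∨ˡ (⟶-modulus s)
⟶-modulus (∨ʳ s) = mapModulus ∨ʳ (⟶-modulus s)
⟶-modulus (∃₁ s) = mapModulus ∃₁_ (⟶-modulus s)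
⟶-modulus (∀₁ s) = mapModulus ∀₁_ (⟶-modulus s)
⟶-modulus (∃₂ s) = mapModulus ∃₂_ (⟶-modulus s)
⟶-modulus (∀₂ s) = mapModulus ∀₂_ (⟶-modulus s)

-- A derivation has finitely many steps, each inserting finitely many predicates, so a product of
-- their moduli serves for all of them.
enrichment-modulus : {F : Fragment σ ℓ} → ∀ {φ} → Enrichment F MOD φ →
                     BoundedModulus (λ d → Enrichment F (MOD∣ d) φ)
enrichment-modulus (base p)           = 1 , _ , base p
enrichment-modulus {σ = σ} (substitution e s) =
  commonModulus (λ c∣d → enrichment-mono (MOD∣-mono c∣d)) (λ c∣d → ⟶-mono (∪-MOD∣-mono σ c∣d))
    substitution (enrichment-modulus e) (⟶-modulus s)

-- Definability with modular predicates through marked languages.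

MarkedBy : ∀ d .{{_ : NonZero d}} → (Fin d → Language (n * d)) → Language n → Set
MarkedBy d K L = ∀ u → L u ⇔ K (origin ⊕ length u) (mark origin u)

⋁ : (j : ℕ) → (Fin j → Sentence) → Sentence
⋁ zero    φ = false
⋁ (suc j) φ = φ fzero ∨ ⋁ j (φ ∘ fsuc)

⊨-⋁ : ∀ (u : Word n) j φ → (∃[ i ] u ⊨ φ i) ⇔ u ⊨ ⋁ j φ
⊨-⋁ u zero    φ = mk⇔ (λ ()) (λ ())
⊨-⋁ u (suc j) φ = mk⇔
  (λ { (fzero , h) → inj₁ h ; (fsuc i , h) → inj₂ (to (⊨-⋁ u j (φ ∘ fsuc)) (i , h)) })
  (λ { (inj₁ h) → fzero , h ; (inj₂ h) → let i , h′ = from (⊨-⋁ u j (φ ∘ fsuc)) h in fsuc i , h′ })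

⋁-* : ∀ j {φ ψ : Fin j → Sentence} → (∀ i → φ i ⟶[ σ ]* ψ i) → ⋁ j φ ⟶[ σ ]* ⋁ j ψ
⋁-* zero    s = ε
⋁-* (suc j) s = gmap (_∨ _) ∨ˡ (s fzero) ◅◅ gmap (_ ∨_) ∨ʳ (⋁-* j (s ∘ fsuc))

module _ (F : Fragment σ ℓ) where
  open Fragment F hiding (substitution) renaming (quantifierFree to quantifierFree⇒member)

  ⋁-member : ∀ j {φ} → (∀ i → member (φ i)) → member (⋁ j φ)
  ⋁-member zero    p = quantifierFree⇒member tt tt
  ⋁-member (suc j) p = disjunction (p fzero) (⋁-member j (p ∘ fsuc))

  -- The fragment contains the disjunction of the `φ i ∧ true`. Substitution translates the atoms of
  -- `φ i` by `unmark` and turns the placeholder `true` into the length constant for `i`, which has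
  -- no free variables either.
  markedBy⇒definable : ∀ d .{{_ : NonZero d}} {K : Fin d → Language (n * d)} {L : Language n} →
                       (∀ i → ⟦ F ⟧ (K i)) → MarkedBy d K L → ⟦_,_⟧ F (MOD^ d) L
  markedBy⇒definable d {K} {L} definable marked = ⋁ d target ,
    enrichment-* (base (⋁-member d (λ i → conjunction (φ∈F i) (quantifierFree⇒member tt tt))))
      (⋁-* d source⟶target) ,
    λ u → marked u ⨾ mk⇔ (to′ u) (from′ u) ⨾ ⊨-⋁ u d target
    where
    φ : Fin d → Sentence
    φ i = proj₁ (definable i)

    φ∈F : ∀ i → member (φ i)
    φ∈F i = proj₁ (proj₂ (definable i))

    target : Fin d → Sentence
    target i = translate (unmark d) (φ i) (member⇒MSO (φ∈F i)) ∧ num (modLength d i) []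

    source⟶target : ∀ i → (φ i ∧ true) ⟶[ σ ∪ MOD^ d ]* target i
    source⟶target i = gmap (_∧ true) ∧ˡ (⟶*-translate (unmark d) (φ i) (member⇒MSO (φ∈F i))) ◅◅
      (∧ʳ (here tt tt (inj₂ (i , inj₂ refl)) ((λ x → mk⇔ (λ ()) (λ ())) , (λ X → ⇔-id _))) ◅ ε)

    defines : ∀ u i → K i (mark origin u) ⇔ u ⊨ translate (unmark d) (φ i) (member⇒MSO (φ∈F i))
    defines u i = proj₂ (proj₂ (definable i)) (mark origin u) ⨾
                  unmark-⊨ d u (φ i) (member⇒MSO (φ∈F i))

    to′ : ∀ u → K (origin ⊕ length u) (mark origin u) → ∃[ i ] u ⊨ target i
    to′ u h = let i = origin ⊕ length u in
      i , to (defines u i) h , ≡⇒≡ᵇ _ _ (sym (toℕ-origin⊕ (length u)))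

    from′ : ∀ u → (∃[ i ] u ⊨ target i) → K (origin ⊕ length u) (mark origin u)
    -- The length constant forces `i` to be the residue of the length of `u`.
    from′ u (i , h , t) = subst (λ j → K j (mark origin u))
      (toℕ-injective (trans (sym (≡ᵇ⇒≡ _ _ t)) (sym (toℕ-origin⊕ (length u)))))
      (from (defines u i) h)

  -- Induction on the derivation: a formula of the fragment reaches its translation by steps over
  -- `σ`, and every later step of the enrichment translates to a step over `σ`. The fragment is
  -- closed under both.
  toMarked-member : ∀ n d r .{{_ : NonZero d}} {φ} → Enrichment F (MOD∣ d) φ →
    Σ[ p ∈ φ ∈MSO[ σ ∪ MOD∣ d ] ] member (translate (toMarked n d r) φ p)
  toMarked-member n d r (base {φ} φ∈F) =
    let p = ∈MSO-mono inj₁ φ (member⇒MSO φ∈F)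
    in p , member-* F φ∈F (⟶*-translate (toMarked n d r) φ p)
  toMarked-member n d r (substitution e s) =
    let p , φ∈F = toMarked-member n d r e
        p′ , s′ = translate-step (toMarked n d r) s p
    in p′ , Fragment.substitution F φ∈F s′

  -- Every multiple of `c` is offered, so that the modulus can later be made divisible by the
  -- stability index as well.
  definable⇒markedBy : {L : Language n} → ⟦_,_⟧ F MOD L →
    ∃[ c ] NonZero c × (∀ d .{{_ : NonZero d}} → c ∣ d →
      Σ[ K ∈ (Fin d → Language (n * d)) ] (∀ i → ⟦ F ⟧ (K i)) × MarkedBy d K L)
  definable⇒markedBy {n} {L} (φ , φ∈ , defines) with enrichment-modulus φ∈
  ... | c , nz , φ∈c = c , nz , λ d c∣d →
    let φ∈d = enrichment-mono (MOD∣-mono c∣d) φ∈c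
        member′ = λ (i : Fin d) → toMarked-member n d (toℕ i) φ∈d
    in (λ i w → w ⊨ translate (toMarked n d (toℕ i)) φ (proj₁ (member′ i)))
     , (λ i → translate (toMarked n d (toℕ i)) φ (proj₁ (member′ i)) , proj₂ (member′ i) ,
          λ _ → ⇔-id _)
     , λ u → defines u ⨾ toMarked-⊨ n d (toℕ (origin ⊕ length u)) u φ _
               (sym (trans (cong (_% d) (toℕ-origin⊕ (length u))) (m%n%n≡m%n (length u) d)))

-- Words up to a right congruence

module _ (S : Setoid 0ℓ 0ℓ) where
  private module S = Setoid S
  open S using (_≈_)
  open Unique S using (Unique)

  unique⇒lookup-injective : ∀ {xs} → Unique xs → ∀ i j → lookup xs i ≈ lookup xs j → i ≡ j
  unique⇒lookup-injective (_ ∷ _)  fzero    fzero    _ = refl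
  unique⇒lookup-injective (p ∷ _)  fzero    (fsuc j) e = contradiction e (All.lookup p (∈-lookup j))
  unique⇒lookup-injective (p ∷ _)  (fsuc i) fzero    e =
    contradiction (S.sym e) (All.lookup p (∈-lookup i))
  unique⇒lookup-injective (_ ∷ ps) (fsuc i) (fsuc j) e = cong fsuc (unique⇒lookup-injective ps i j e)

  -- Deduplication leaves one entry per class, and the index of that entry is the bijection with
  -- `Fin`.
  enumerable⇒finite : Decidable _≈_ → ∀ {xs} → IsEnumeration S xs → Finite S
  enumerable⇒finite _≟_ {xs} enumerates = length ys , record
    { to        = position
    ; from      = lookup ys
    ; to-cong   = λ {x} {y} x≈y → injective (S.trans (S.sym (found x)) (S.trans x≈y (found y)))
    ; from-cong = λ { refl → S.refl }
    ; inverse   = (λ {i} {x} x≈yᵢ → injective (S.trans (S.sym (found x)) x≈yᵢ))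
                , (λ { {x} refl → S.sym (found x) })
    }
    where
    decSetoid : DecSetoid 0ℓ 0ℓ
    decSetoid = record
      { isDecEquivalence = record { isEquivalence = S.isEquivalence ; _≟_ = _≟_ } }

    ys       = deduplicate _≟_ xs
    ∈ys      = deduplicate⁺ decSetoid enumerates
    position = λ x → index (∈ys x)

    injective : ∀ {i j} → lookup ys i ≈ lookup ys j → i ≡ j
    injective = unique⇒lookup-injective (deduplicate-! decSetoid xs) _ _

    found : ∀ x → x ≈ lookup ys (position x)
    found x = lookup-index (∈ys x)

finite⇒decidable : (S : Setoid 0ℓ 0ℓ) → Finite S → Decidable (Setoid._≈_ S)
finite⇒decidable S (_ , fin) x y =
  map′ (Injection.injective (Inverse⇒Injection fin)) I.to-cong (I.to x ≟F I.to y)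
  where module I = Inverse fin

wordsBelow : ℕ → List (Word n)
wordsBelow zero    = []
wordsBelow (suc b) = [] ∷ cartesianProductWith _∷_ (allFin _) (wordsBelow b)

∈-wordsBelow : ∀ {b} (u : Word n) → length u < b → u ∈ wordsBelow b
∈-wordsBelow []      (s≤s _) = here refl
∈-wordsBelow (a ∷ u) (s≤s p) =
  there (∈-cartesianProductWith⁺ _∷_ (∈-allFin a) (∈-wordsBelow u p))

module _ {P : Word n → Set} (P? : Unary.Decidable P) (b : ℕ) where

  ∃<? : Dec (∃[ u ] length u < b × P u)
  ∃<? = map′ satisfied (λ (u , p) → lose (∈-wordsBelow u (proj₁ p)) p)
    (any? (λ u → (length u <? b) ×-dec P? u) (wordsBelow b))

  ∀<? : Dec (∀ u → length u < b → P u)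
  ∀<? = map′ (λ h u u< → All.lookup h (∈-wordsBelow u u<) u<) (λ h → All.tabulate (λ {u} _ → h u))
    (all? (λ u → (length u <? b) →-dec P? u) (wordsBelow b))

∃-length? : {P : Word n → Set} → Unary.Decidable P → ∀ k → Dec (∃[ u ] length u ≡ k × P u)
∃-length? P? k = map′ (λ (u , _ , p) → u , p) (λ { (u , refl , p) → u , n<1+n _ , refl , p })
  (∃<? (λ u → (length u ≟ℕ k) ×-dec P? u) (suc k))

module _ {P : Word n → Set} (P? : Unary.Decidable P) {_≈_ : Rel (Word n) 0ℓ}
         (isEquivalence : IsEquivalence _≈_) (_≟_ : Decidable _≈_) where

  subsetoid : Setoid 0ℓ 0ℓ
  subsetoid = record
    { Carrier = Σ (Word n) P ; isEquivalence = On.isEquivalence proj₁ isEquivalence }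

  -- The words shorter than `b` can be listed; those satisfying `P` meet every class.
  bounded⇒finite : ∀ b → (∀ u → P u → ∃[ v ] length v < b × P v × u ≈ v) → Finite subsetoid
  bounded⇒finite b short = enumerable⇒finite subsetoid (λ x y → proj₁ x ≟ proj₁ y) enumerates
    where
    select : Word n → List (Σ (Word n) P)
    select u with P? u
    ... | yes p = (u , p) ∷ []
    ... | no _  = []

    ∈-select : ∀ {u v} → P v → u ≈ v → Any (λ x → u ≈ proj₁ x) (select v)
    ∈-select {v = v} p e with P? v
    ... | yes _ = here e
    ... | no ¬p = contradiction p ¬p

    enumerates : IsEnumeration subsetoid (concatMap select (wordsBelow b))
    enumerates (u , p) with short u p
    ... | v , v<b , q , u≈v = concatMap⁺ select (Any.map (λ { refl → ∈-select q u≈v }) (∈-wordsBelow v v<b))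

split : ∀ i {t} (u : Word n) → length u ≡ i + t →
        ∃[ v ] ∃[ w ] v ++ w ≡ u × length v ≡ i × length w ≡ t
split zero    u       e = [] , u , refl , refl , e
split (suc i) (a ∷ u) e with split i u (suc-injective e)
... | v , w , refl , p , q = a ∷ v , w , refl , cong suc p , q

module RightCongruence {_~_ : Rel (Word n) 0ℓ} (isEquivalence : IsEquivalence _~_)
                       (++-congʳ : ∀ {u v} → u ~ v → ∀ w → (u ++ w) ~ (v ++ w)) where
  private module ~ = IsEquivalence isEquivalence

  -- In the quotient by `_~_`, this is the inclusion of the image of the words of length `i` in the
  -- image of the words of length `j`.
  _⊑_ : ℕ → ℕ → Set
  i ⊑ j = ∀ u → length u ≡ i → ∃[ v ] length v ≡ j × v ~ u

  ⊑-trans : ∀ {i j l} → i ⊑ j → j ⊑ l → i ⊑ l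
  ⊑-trans p q u e with p u e
  ... | v , f , v~u with q v f
  ... | w , g , w~v = w , g , ~.trans w~v v~u

  -- Only a prefix of length `i` is exchanged, so compatibility with appending on the right is
  -- enough.
  ⊑-+ : ∀ {i j} t → i ⊑ j → (i + t) ⊑ (j + t)
  ⊑-+ {i} t p u e with split i u e
  ... | v , w , refl , f , g with p v f
  ... | v′ , f′ , v′~v = v′ ++ w , trans (length-++ v′) (cong₂ _+_ f′ g) , ++-congʳ v′~v w

  module Periodic {i p} (up : i ⊑ (i + p)) (down : (i + p) ⊑ i) where

    private
      shift : ∀ {t} → i ≤ t → i + p + (t ∸ i) ≡ t + p
      shift {t} i≤t = begin
        i + p + (t ∸ i)    ≡⟨ +-assoc i p (t ∸ i) ⟩
        i + (p + (t ∸ i))  ≡⟨ cong (i +_) (+-comm p (t ∸ i)) ⟩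
        i + ((t ∸ i) + p)  ≡⟨ +-assoc i (t ∸ i) p ⟨
        i + (t ∸ i) + p    ≡⟨ cong (_+ p) (m+[n∸m]≡n i≤t) ⟩
        t + p              ∎
        where open ≡-Reasoning

    -- Appending `t ∸ i` letters moves the two inclusions from `i` to `t`.
    ⊑-period : ∀ {t} → i ≤ t → t ⊑ (t + p) × (t + p) ⊑ t
    ⊑-period {t} i≤t =
      subst₂ _⊑_ (m+[n∸m]≡n i≤t) (shift i≤t) (⊑-+ (t ∸ i) up) ,
      subst₂ _⊑_ (shift i≤t) (m+[n∸m]≡n i≤t) (⊑-+ (t ∸ i) down)

    ⊑-periods : ∀ {t} m → i ≤ t → t ⊑ (t + m * p) × (t + m * p) ⊑ t
    ⊑-periods {t} zero    i≤t rewrite +-identityʳ t = same , same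
      where same = λ u e → u , e , ~.refl
    ⊑-periods {t} (suc m) i≤t with ⊑-period i≤t | ⊑-periods m (≤-trans i≤t (m≤m+n t p))
    ... | a , b | c , d rewrite +-assoc t p (m * p) = ⊑-trans a c , ⊑-trans d b

    -- The excess of the length over `i` is reduced modulo `p`. The number `m` of removed periods is
    -- kept, since later uses need the length modulo `p`.
    bounded : .{{_ : NonZero p}} → ∀ u →
              ∃[ v ] ∃[ m ] length v < i + p × length u ≡ length v + m * p × v ~ u
    bounded u with length u <? i + p
    ... | yes u< = u , 0 , u< , sym (+-identityʳ _) , ~.refl
    ... | no  u≮ = v , c , subst (_< i + p) (sym |v|) (+-monoʳ-< i (m%n<n (length u ∸ i) p)) ,
                   trans |u| (cong (_+ c * p) (sym |v|)) , v~u
      where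
      c = (length u ∸ i) / p
      t = i + (length u ∸ i) % p

      |u| : length u ≡ t + c * p
      |u| = begin
        length u                                 ≡⟨ m+[n∸m]≡n (≤-trans (m≤m+n i p) (≮⇒≥ u≮)) ⟨
        i + (length u ∸ i)                       ≡⟨ cong (i +_) (m≡m%n+[m/n]*n (length u ∸ i) p) ⟩
        i + ((length u ∸ i) % p + c * p)         ≡⟨ +-assoc i _ (c * p) ⟨
        t + c * p                                ∎
        where open ≡-Reasoning

      reduced : ∃[ v ] length v ≡ t × v ~ u
      reduced = proj₂ (⊑-periods c (m≤m+n i _)) u |u|

      v   = proj₁ reduced
      |v| = proj₁ (proj₂ reduced)
      v~u = proj₂ (proj₂ reduced)

module _ {q} (f : Word n → Fin q) (f-cong : ∀ {u v} → f u ≡ f v → ∀ w → f (u ++ w) ≡ f (v ++ w)) where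
  open RightCongruence (On.isEquivalence f isEquivalence) (λ {u} {v} → f-cong {u} {v})

  private
    hit? : ∀ k x → Dec (∃[ u ] length u ≡ k × f u ≡ x)
    hit? k x = ∃-length? (λ u → f u ≟F x) k

    bit : Bool → Fin 2
    bit b = if b then fsuc fzero else fzero

    -- The set f (A^ k), coded as a number.
    code : ℕ → Fin (2 ^ q)
    code k = funToFin (λ x → bit (does (hit? k x)))

    bit-transfer : {A B : Set} (a? : Dec A) (b? : Dec B) → bit (does a?) ≡ bit (does b?) → A → B
    bit-transfer _        (yes b) _ _ = b
    bit-transfer (no ¬a)  (no _)  _ a = contradiction a ¬a

    code-≡ : ∀ {i j} → code i ≡ code j → i ⊑ j
    code-≡ {i} {j} e u |u| = bit-transfer (hit? i (f u)) (hit? j (f u)) (begin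
      bit (does (hit? i (f u)))    ≡⟨ finToFun-funToFin _ (f u) ⟨
      finToFun (code i) (f u)      ≡⟨ cong (λ c → finToFun c (f u)) e ⟩
      finToFun (code j) (f u)      ≡⟨ finToFun-funToFin _ (f u) ⟩
      bit (does (hit? j (f u)))    ∎) (u , |u| , refl)
      where open ≡-Reasoning

  -- `Fin q` has `2 ^ q` subsets, so two of the first `2 ^ q + 1` lengths have the same image under
  -- `f`.
  eventuallyPeriodic : ∃[ i ] ∃[ p ] NonZero p × i ⊑ (i + p) × (i + p) ⊑ i
  eventuallyPeriodic with pigeonhole (n<1+n (2 ^ q)) (code ∘ toℕ)
  ... | i , j , i<j , e = toℕ i , toℕ j ∸ toℕ i , >-nonZero (m<n⇒0<n∸m i<j) ,
    subst (toℕ i ⊑_) (sym i+[j∸i]) (code-≡ e) , subst (_⊑ toℕ i) (sym i+[j∸i]) (code-≡ (sym e))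
    where i+[j∸i] = m+[n∸m]≡n (<⇒≤ i<j)

  boundedRepresentatives : ∃[ b ] ∀ u → ∃[ v ] length v < b × f v ≡ f u
  boundedRepresentatives with eventuallyPeriodic
  ... | i , p , nz , up , down = i + p , λ u →
    let v , _ , v< , _ , e = Periodic.bounded up down {{nz}} u in v , v< , e

-- The stable monoid

_⇔-dec_ : {A B : Set} → Dec A → Dec B → Dec (A ⇔ B)
a? ⇔-dec b? = map′ (λ (f , g) → mk⇔ f g) (λ e → to e , from e) ((a? →-dec b?) ×-dec (b? →-dec a?))

module _ {d} .{{_ : NonZero d}} where

  ⊕-period : ∀ (e : Fin d) k c → e ⊕ (k + c * d) ≡ e ⊕ k
  ⊕-period e k c = toℕ-injective (begin
    toℕ (e ⊕ (k + c * d))      ≡⟨ toℕ-⊕ e (k + c * d) ⟩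
    (toℕ e + (k + c * d)) % d  ≡⟨ cong (_% d) (+-assoc (toℕ e) k (c * d)) ⟨
    (toℕ e + k + c * d) % d    ≡⟨ [m+kn]%n≡m%n (toℕ e + k) c d ⟩
    (toℕ e + k) % d            ≡⟨ toℕ-⊕ e k ⟨
    toℕ (e ⊕ k)                ∎)
    where open ≡-Reasoning

  ∣⇒⊕≡ : ∀ (e : Fin d) {k} → d ∣ k → e ⊕ k ≡ e
  ∣⇒⊕≡ e (divides-refl c) = trans (⊕-period e 0 c) (⊕-identityʳ e)

  -- Adding `d ∸ toℕ e` cancels `e`, which reduces the claim to the residue 0.
  ⊕≡⇒∣ : ∀ (e : Fin d) k → e ⊕ k ≡ e → d ∣ k
  ⊕≡⇒∣ e k e⊕k≡e = m%n≡0⇒n∣m k d (begin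
    k % d                            ≡⟨ toℕ-origin⊕ k ⟨
    toℕ (origin ⊕ k)                 ≡⟨ cong (λ z → toℕ (z ⊕ k)) e⊕c ⟨
    toℕ (e ⊕ c ⊕ k)                  ≡⟨ cong toℕ (⊕-⊕ e c k) ⟩
    toℕ (e ⊕ (c + k))                ≡⟨ cong (λ z → toℕ (e ⊕ z)) (+-comm c k) ⟩
    toℕ (e ⊕ (k + c))                ≡⟨ cong toℕ (⊕-⊕ e k c) ⟨
    toℕ (e ⊕ k ⊕ c)                  ≡⟨ cong (λ z → toℕ (z ⊕ c)) e⊕k≡e ⟩
    toℕ (e ⊕ c)                      ≡⟨ cong toℕ e⊕c ⟩
    toℕ (origin {d})                 ≡⟨ cong toℕ (⊕-identityʳ origin) ⟨
    toℕ (origin {d} ⊕ 0)             ≡⟨ toℕ-origin⊕ 0 ⟩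
    0 % d                            ≡⟨ m*n%n≡0 0 d ⟩
    0                                ∎)
    where
    open ≡-Reasoning
    c = d ∸ toℕ e

    e⊕c : e ⊕ c ≡ origin
    e⊕c = toℕ-injective (begin
      toℕ (e ⊕ c)       ≡⟨ toℕ-⊕ e c ⟩
      (toℕ e + c) % d   ≡⟨ cong (_% d) (m+[n∸m]≡n (<⇒≤ (toℕ<n e))) ⟩
      d % d             ≡⟨ n%n≡0 d ⟩
      0                 ≡⟨ m*n%n≡0 0 d ⟨
      0 % d             ≡⟨ toℕ-origin⊕ 0 ⟨
      toℕ (origin {d} ⊕ 0)  ≡⟨ cong toℕ (⊕-identityʳ origin) ⟩
      toℕ (origin {d})  ∎)

  -- A word of length divisible by `d` returns the residue to `e`; on such words marking from `e` is
  -- therefore a morphism.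
  mark-∣ : ∀ e (u v : Word n) → d ∣ length u → mark e (u ++ v) ≡ mark e u ++ mark e v
  mark-∣ e u v d∣u = trans (mark-++ e u v) (cong (λ z → mark e u ++ mark z v) (∣⇒⊕≡ e d∣u))

-- Together with `∣⇒⋆`, this turns membership in the star of `A^ s` into a condition on the length
-- alone.
⋆⇒∣ : ∀ s {u : Word n} → (A^ s ⋆) u → s ∣ length u
⋆⇒∣ s (us , ps , refl) = blocks us ps
  where
  blocks : ∀ us → All (A^ s) us → s ∣ length (concat us)
  blocks []       []          = s ∣0
  blocks (u ∷ us) (refl ∷ ps) =
    subst (s ∣_) (sym (length-++ u)) (∣m∣n⇒∣m+n ∣-refl (blocks us ps))

∣⇒⋆ : ∀ s {u : Word n} → s ∣ length u → (A^ s ⋆) u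
∣⇒⋆ {n} s (divides c e) = blocks c _ e
  where
  blocks : ∀ c (u : Word n) → length u ≡ c * s → (A^ s ⋆) u
  blocks zero    []      e = [] , [] , refl
  blocks (suc c) u e with split s u e
  ... | v , w , refl , |v| , |w| with blocks c w |w|
  ... | ws , ps , concat≡w = v ∷ ws , |v| ∷ ps , cong (v ++_) concat≡w

module _ (L : Language n) where
  private
    module Syn = Monoid (syntacticMonoid L)

    _≋_ : Rel (Word n) 0ℓ
    _≋_ = SyntacticCongruence L

  ≋-++ : ∀ (u u′ v v′ : Word n) → u ≋ u′ → v ≋ v′ → (u ++ v) ≋ (u′ ++ v′)
  ≋-++ u u′ v v′ = Syn.∙-cong {u} {u′} {v} {v′}

  ≋-resp : ∀ u v → u ≋ v → L u → L v
  ≋-resp u v u≋v = subst L (++-identityʳ v) ∘ to (u≋v [] []) ∘ subst L (sym (++-identityʳ u))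

  open RightCongruence {_~_ = _≋_} Syn.isEquivalence
    (λ {u} {v} u≋v w → ≋-++ u v w w u≋v (Syn.refl {w}))

  module StableExponent (L? : Unary.Decidable L) (s : ℕ) .{{_ : NonZero s}}
                        (stable : Stable (syntacticMorphism L) s) where

    private
      N = stableMonoid (syntacticMorphism L) s

      s+s : 2 * s ≡ s + s
      s+s = cong (s +_) (+-identityʳ s)

    -- Stability is periodicity with threshold and period both `s`: every word is congruent to one
    -- shorter than `s + s`, of the same length modulo `s`.
    open Periodic {s} {s}
      (subst (s ⊑_) s+s (λ u e → proj₁ stable {u} (u , e , Syn.refl {u})))
      (subst (_⊑ s) s+s (λ u e → proj₂ stable {u} (u , e , Syn.refl {u}))) public

    -- Any context may be exchanged for a congruent short one, so finitely many contexts have to be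
    -- tested.
    _≋?_ : Decidable _≋_
    u ≋? v = map′ extend (λ u≋v x _ y _ → u≋v x y)
      (∀<? (λ x → ∀<? (λ y → L? (x ++ u ++ y) ⇔-dec L? (x ++ v ++ y)) (s + s)) (s + s))
      where
      extend : (∀ x → length x < s + s → ∀ y → length y < s + s →
                L (x ++ u ++ y) ⇔ L (x ++ v ++ y)) → u ≋ v
      extend h x y with bounded x | bounded y
      ... | x′ , _ , x′< , _ , x′≋x | y′ , _ , y′< , _ , y′≋y =
        ⇔-sym (context u) ⨾ h x′ x′< y′ y′< ⨾ context v
        where
        context : ∀ w → L (x′ ++ w ++ y′) ⇔ L (x ++ w ++ y)
        context w = mk⇔ (≋-resp _ _ e) (≋-resp _ _ (Syn.sym {x′ ++ w ++ y′} {x ++ w ++ y} e))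
          where e = ≋-++ x′ x (w ++ y′) (w ++ y) x′≋x (≋-++ w w y′ y (Syn.refl {w}) y′≋y)

    toStable : (u : Word n) → s ∣ length u → Monoid.Carrier N
    toStable u s∣u = u , u , ∣⇒⋆ s s∣u , Syn.refl {u}

    -- Shortening removes a multiple of `s` from the length, which preserves divisibility by `s`.
    shortStable : ∀ {u} → Image (syntacticMorphism L) (A^ s ⋆) u →
                  ∃[ v ] length v < s + s × s ∣ length v × v ≋ u
    shortStable {u} (w , w∈⋆ , w≋u) with bounded w
    ... | v , c , v< , |w| , v≋w =
      v , v< , ∣m+n∣m⇒∣n (subst (s ∣_) (trans |w| (+-comm (length v) (c * s))) (⋆⇒∣ s w∈⋆)) (n∣m*n c) ,
      Syn.trans {v} {w} {u} v≋w w≋u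

    stableMonoid-finite : FiniteMonoid N
    stableMonoid-finite = bounded⇒finite image? Syn.isEquivalence _≋?_ (s + s)
      (λ u p → let v , v< , s∣v , v≋u = shortStable p in
         v , v< , (v , ∣⇒⋆ s s∣v , Syn.refl {v}) , Syn.sym {v} {u} v≋u)
      where
      -- By `shortStable` the search for a preimage can stop at length `s + s`.
      image? : Unary.Decidable (Image (syntacticMorphism L) (A^ s ⋆))
      image? u = map′ (λ (v , _ , s∣v , v≋u) → v , ∣⇒⋆ s s∣v , v≋u) shortStable
        (∃<? (λ v → (s ∣? length v) ×-dec (v ≋? u)) (s + s))

-- Regular languages and the existence of a stable exponent.

module _ {L : Language n} where

  module _ {M : Mon} (R : Recognizes M L) where
    open Recognizes R
    open Monoid M using (_≈_; ∙-cong) renaming (refl to ≈-refl; sym to ≈-sym; trans to ≈-trans)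
    open IsMonoidHomomorphism (isHomomorphism morphism) using (homo)

    recognizes⇒decidable : Unary.Decidable L
    recognizes⇒decidable u = map′ (from (preimage u)) (to (preimage u)) (accept? (apply morphism u))

    recognized-resp : ∀ {u v} → apply morphism u ≈ apply morphism v → L u ⇔ L v
    recognized-resp {u} {v} e =
      preimage u ⨾ mk⇔ (accept-≈ e) (accept-≈ (≈-sym e)) ⨾ ⇔-sym (preimage v)

    apply-++ : ∀ {u u′ v v′} → apply morphism u ≈ apply morphism u′ →
               apply morphism v ≈ apply morphism v′ → apply morphism (u ++ v) ≈ apply morphism (u′ ++ v′)
    apply-++ {u} {u′} {v} {v′} p q = ≈-trans (homo u v) (≈-trans (∙-cong p q) (≈-sym (homo u′ v′)))

    recognized⇒≋ : ∀ {u v} → apply morphism u ≈ apply morphism v → SyntacticCongruence L u v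
    recognized⇒≋ {u} {v} e x y = recognized-resp
      (apply-++ {x} {x} {u ++ y} {v ++ y} ≈-refl (apply-++ {u} {v} {y} {y} e ≈-refl))

  regular⇒decidable : Regular L → Unary.Decidable L
  regular⇒decidable (_ , _ , R) = recognizes⇒decidable R

  regular⇒stable : Regular L → ∃[ s ] Σ[ nz ∈ NonZero s ] Stable (syntacticMorphism L) s
  -- `suc i * p` is a nonzero multiple of the period lying above the threshold `i`, so doubling it
  -- just adds `suc i` periods.
  regular⇒stable (M , (q , fin) , R) = suc i * p , m*n≢0 (suc i) p {{_}} {{nz}} ,
    (λ (u , |u| , u≋x) → let v , |v| , e = proj₁ s⊑s+s u |u| in
       v , trans |v| (sym s+s) , ≋-trans {v} {u} (≋ v u e) u≋x) ,
    (λ (u , |u| , u≋x) → let v , |v| , e = proj₂ s⊑s+s u (trans |u| s+s) in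
       v , |v| , ≋-trans {v} {u} (≋ v u e) u≋x)
    where
    open Recognizes R
    open Monoid M using () renaming (refl to ≈-refl)
    open Monoid (syntacticMonoid L) using () renaming (trans to ≋-trans)
    module I = Inverse fin
    open Injection (Inverse⇒Injection fin) using (injective)

    f : Word n → Fin q
    f u = I.to (apply morphism u)

    f-cong : ∀ {u v} → f u ≡ f v → ∀ w → f (u ++ w) ≡ f (v ++ w)
    f-cong {u} {v} e w = I.to-cong (apply-++ R {u} {v} {w} {w} (injective e) ≈-refl)

    ≋ : ∀ u v → f u ≡ f v → SyntacticCongruence L u v
    ≋ u v e = recognized⇒≋ R {u} {v} (injective e)

    period = eventuallyPeriodic f (λ {u} {v} → f-cong {u} {v})
    i      = proj₁ period
    p      = proj₁ (proj₂ period)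
    nz     = proj₁ (proj₂ (proj₂ period))
    updown = proj₂ (proj₂ (proj₂ period))

    open RightCongruence {_~_ = λ u v → f u ≡ f v} (On.isEquivalence f isEquivalence)
      (λ {u} {v} → f-cong {u} {v})
    open Periodic (proj₁ updown) (proj₂ updown)

    s+s : 2 * (suc i * p) ≡ suc i * p + suc i * p
    s+s = cong (suc i * p +_) (+-identityʳ (suc i * p))

    s⊑s+s : (suc i * p) ⊑ (suc i * p + suc i * p) × (suc i * p + suc i * p) ⊑ (suc i * p)
    s⊑s+s = ⊑-periods (suc i) (≤-trans (n≤1+n i) (m≤m*n (suc i) p {{nz}}))

-- Membership in a variety through kernels of morphisms.

module _ (W : Mon) where
  private module W = Monoid W

  -- The kernel of f, as a congruence on W, yields the submonoid of M in the
  -- division.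
  quotient-≼ : ∀ {M N : Mon} {f : W.Carrier → Monoid.Carrier M} {g : W.Carrier → Monoid.Carrier N} →
    IsMonoidHomomorphism W.rawMonoid (Monoid.rawMonoid M) f →
    IsMonoidHomomorphism W.rawMonoid (Monoid.rawMonoid N) g →
    (∀ y → ∃[ x ] Monoid._≈_ N (g x) y) →
    (∀ {x y} → Monoid._≈_ M (f x) (f y) → Monoid._≈_ N (g x) (g y)) →
    N ≼ M
  quotient-≼ {M} {N} {f} {g} f-hom g-hom g-surjective f⇒g = record
    { S            = S
    ; ι            = f
    ; ι-embedding  = record
      { isMonoidHomomorphism = record
        { isMagmaHomomorphism = record
          { isRelHomomorphism = record { cong = id } ; homo = F.homo }
        ; ε-homo = F.ε-homo }
      ; injective = id }
    ; π            = g
    ; π-morphism   = record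
      { isMagmaHomomorphism = record
        { isRelHomomorphism = record { cong = f⇒g } ; homo = G.homo }
      ; ε-homo = G.ε-homo }
    ; π-surjective = λ y → let x , gx≈y = g-surjective y in
        x , λ z≈x → N.trans (f⇒g z≈x) gx≈y
    }
    where
    module M = Monoid M
    module N = Monoid N
    module F = IsMonoidHomomorphism f-hom
    module G = IsMonoidHomomorphism g-hom

    S : Mon
    S = record
      { Carrier  = W.Carrier
      ; _≈_      = λ x y → f x M.≈ f y
      ; _∙_      = W._∙_
      ; ε        = W.ε
      ; isMonoid = record
        { isSemigroup = record
          { isMagma = record
            { isEquivalence = On.isEquivalence f M.isEquivalence
            ; ∙-cong        = λ {x} {x′} {y} {y′} p q →
                M.trans (F.homo x y) (M.trans (M.∙-cong p q) (M.sym (F.homo x′ y′)))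
            }
          ; assoc = λ x y z → F.⟦⟧-cong (W.assoc x y z)
          }
        ; identity = (λ x → F.⟦⟧-cong (W.identityˡ x)) , (λ x → F.⟦⟧-cong (W.identityʳ x))
        }
      }

  record HomInto (V : Variety ℓ) : Set (lsuc 0ℓ ⊔ ℓ) where
    field
      {target}  : Mon
      target∈V  : Variety.member V target
      {map}     : W.Carrier → Monoid.Carrier target
      map-hom   : IsMonoidHomomorphism W.rawMonoid (Monoid.rawMonoid target) map

    Kernel : Rel W.Carrier 0ℓ
    Kernel x y = Monoid._≈_ target (map x) (map y)

  open HomInto

  -- The target is the product of the given targets. The empty family is sent to the neutral element
  -- of the monoid supplied by `nonempty`.
  joint : (V : Variety ℓ) → ∀ j (h : Fin j → HomInto V) →
          Σ[ H ∈ HomInto V ] (∀ {x y} → Kernel H x y → ∀ i → Kernel (h i) x y)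
  joint V zero    h = record
    { target∈V = proj₂ (Variety.nonempty V)
    ; map      = λ _ → M.ε
    ; map-hom  = record
      { isMagmaHomomorphism = record
        { isRelHomomorphism = record { cong = λ _ → M.refl }
        ; homo              = λ _ _ → M.sym (M.identityˡ M.ε) }
      ; ε-homo = M.refl }
    } , λ _ ()
    where module M = Monoid (proj₁ (Variety.nonempty V))
  joint V (suc j) h with joint V j (h ∘ fsuc)
  ... | H , H⇒h = record
    { target∈V = Variety.product V (target∈V (h fzero)) (target∈V H)
    ; map      = λ x → map (h fzero) x , map H x
    ; map-hom  = record
      { isMagmaHomomorphism = record
        { isRelHomomorphism = record { cong = λ e → A.⟦⟧-cong e , B.⟦⟧-cong e }
        ; homo              = λ x y → A.homo x y , B.homo x y }
      ; ε-homo = A.ε-homo , B.ε-homo }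
    } , λ { (p , q) fzero → p ; (p , q) (fsuc i) → H⇒h q i }
    where
    module A = IsMonoidHomomorphism (map-hom (h fzero))
    module B = IsMonoidHomomorphism (map-hom H)

  -- Serves for the stable monoid, for the local monoids of `lengthCategory` and for the monoid
  -- tested by `member?`.
  quotient-member : (V : Variety ℓ) → ∀ {N : Mon} {g : W.Carrier → Monoid.Carrier N} →
    FiniteMonoid N →
    IsMonoidHomomorphism W.rawMonoid (Monoid.rawMonoid N) g →
    (∀ y → ∃[ x ] Monoid._≈_ N (g x) y) →
    (H : HomInto V) → (∀ {x y} → Kernel H x y → Monoid._≈_ N (g x) (g y)) →
    Variety.member V N
  quotient-member V finite g-hom g-surjective H f⇒g =
    Variety.division V (target∈V H) finite (quotient-≼ (map-hom H) g-hom g-surjective f⇒g)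

-- The stable monoid from recognizers of marked languages.

module _ (V : Variety ℓ) {L : Language n} (L? : Unary.Decidable L) (s : ℕ) .{{_ : NonZero s}}
         (stable : Stable (syntacticMorphism L) s) where
  private
    module Syn = Monoid (syntacticMonoid L)
    N = stableMonoid (syntacticMorphism L) s
  open StableExponent L L? s stable

  markedBy⇒stable-member : ∀ d .{{_ : NonZero d}} → s ∣ d → (K : Fin d → Language (n * d)) →
    (∀ r → ∃[ M ] Variety.member V M × Recognizes M (K r)) → MarkedBy d K L →
    Variety.member V N
  markedBy⇒stable-member d s∣d K recognized marked =
    quotient-member W V stableMonoid-finite g-hom g-surjective (proj₁ H)
      (λ {u} {v} e → kernel⇒≋ u v (λ i r → proj₂ (Hᵢ i) (proj₂ H e i) r))
    where
    W : Mon
    W = record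
      { Carrier  = Σ[ u ∈ Word n ] d ∣ length u
      ; _≈_      = λ u v → proj₁ u ≡ proj₁ v
      ; _∙_      = λ { (u , p) (v , q) → u ++ v , subst (d ∣_) (sym (length-++ u)) (∣m∣n⇒∣m+n p q) }
      ; ε        = [] , d ∣0
      ; isMonoid = record
        { isSemigroup = record
          { isMagma = record
            { isEquivalence = On.isEquivalence proj₁ isEquivalence ; ∙-cong = cong₂ _++_ }
          ; assoc = λ u v w → ++-assoc (proj₁ u) (proj₁ v) (proj₁ w)
          }
        ; identity = (λ u → refl) , (λ u → ++-identityʳ (proj₁ u))
        }
      }

    ψ : ∀ r → Morphism (n * d) (proj₁ (recognized r))
    ψ r = Recognizes.morphism (proj₂ (proj₂ (recognized r)))

    _≈⟨_⟩_ : Word (n * d) → ∀ r → Word (n * d) → Set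
    u ≈⟨ r ⟩ v = Monoid._≈_ (proj₁ (recognized r)) (apply (ψ r) u) (apply (ψ r) v)

    -- All starting residues `i` are needed because a left context may have any length; all `r`
    -- because the total length may have any residue.
    h : Fin d → Fin d → HomInto W V
    h i r = record
      { target∈V = proj₁ (proj₂ (recognized r))
      ; map      = λ u → apply (ψ r) (mark i (proj₁ u))
      ; map-hom  = record
        { isMagmaHomomorphism = record
          { isRelHomomorphism = record { cong = λ { refl → M.refl } }
          ; homo              = λ u v → M.trans
              (M.reflexive (cong (apply (ψ r)) (mark-∣ i (proj₁ u) (proj₁ v) (proj₂ u))))
              (homo _ _)
          }
        ; ε-homo = ε-homo }
      }
      where
      module M = Monoid (proj₁ (recognized r))
      open IsMonoidHomomorphism (isHomomorphism (ψ r)) using (homo; ε-homo)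

    Hᵢ = λ i → joint W V d (h i)
    H  = joint W V d (proj₁ ∘ Hᵢ)

    g-hom : IsMonoidHomomorphism (Monoid.rawMonoid W) (Monoid.rawMonoid N)
              (λ (u , d∣u) → toStable u (∣-trans s∣d d∣u))
    g-hom = record
      { isMagmaHomomorphism = record
        { isRelHomomorphism = record { cong = λ {u} {v} → Syn.reflexive {proj₁ u} {proj₁ v} }
        ; homo              = λ u v → Syn.refl {proj₁ u ++ proj₁ v} }
      ; ε-homo = Syn.refl {[]} }

    -- The words of length divisible by `d` already reach every stable class. A nonempty word of
    -- length `c * s` is lengthened by further periods to `c * d`; length 0 is left alone, as
    -- periodicity only starts at `s`.
    multiple : ∀ c e → d ≡ e * s → ∀ u → length u ≡ c * s →
               ∃[ w ] d ∣ length w × SyntacticCongruence L w u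
    multiple c zero    d≡0 = contradiction d≡0 (≢-nonZero⁻¹ d)
    multiple zero (suc e) d≡ [] _ = [] , d ∣0 , Syn.refl {[]}
    multiple c@(suc c′) (suc e) d≡ u |u| =
      let w , |w| , w≋u = proj₁ (⊑-periods (c * e) (subst (s ≤_) (sym |u|) (m≤m+n s (c′ * s)))) u refl
      in w , divides c (trans |w| lengthens) , w≋u
      where
      lengthens : length u + c * e * s ≡ c * d
      lengthens = begin
        length u + c * e * s   ≡⟨ cong (_+ c * e * s) |u| ⟩
        c * s + c * e * s      ≡⟨ *-distribʳ-+ s c (c * e) ⟨
        (c + c * e) * s        ≡⟨ cong (_* s) (*-suc c e) ⟨
        c * suc e * s          ≡⟨ *-assoc c (suc e) s ⟩
        c * (suc e * s)        ≡⟨ cong (c *_) d≡ ⟨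
        c * d                  ∎
        where open ≡-Reasoning

    g-surjective : ∀ y → ∃[ u ] SyntacticCongruence L (proj₁ u) (proj₁ y)
    g-surjective (x , u , u∈⋆ , u≋x) with ⋆⇒∣ s u∈⋆
    ... | divides c |u| =
      let w , d∣w , w≋u = multiple c (_∣_.quotient s∣d) (_∣_.equality s∣d) u |u|
      in (w , d∣w) , Syn.trans {w} {u} {x} w≋u u≋x

    kernel⇒≋ : ∀ (u v : Monoid.Carrier W) →
               (∀ i r → mark i (proj₁ u) ≈⟨ r ⟩ mark i (proj₁ v)) →
               SyntacticCongruence L (proj₁ u) (proj₁ v)
    kernel⇒≋ (u , d∣u) (v , d∣v) e x y =
      context u d∣u ⨾ recognized-resp (R r) (++-cong {mark origin x} {mark origin x} ≈-refl
        (++-cong {mark i u} {mark i v} (e i r) (≈-refl {apply (ψ r) (mark i y)}))) ⨾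
      ⇔-sym (context v d∣v)
      where
      -- `i` is the residue at which the middle word starts and `r` that of the total length. Both
      -- depend on the context only, as `d` divides the lengths of `u` and `v`.
      i = origin ⊕ length x
      r = i ⊕ length y
      R = λ r → proj₂ (proj₂ (recognized r))
      open Monoid (proj₁ (recognized r)) using () renaming (refl to ≈-refl)

      ++-cong : ∀ {w w′ z z′} → w ≈⟨ r ⟩ w′ → z ≈⟨ r ⟩ z′ → (w ++ z) ≈⟨ r ⟩ (w′ ++ z′)
      ++-cong {w} {w′} {z} {z′} = apply-++ (R r) {w} {w′} {z} {z′}

      residue : ∀ w → d ∣ length w → origin ⊕ length (x ++ w ++ y) ≡ r
      residue w d∣w = begin
        origin ⊕ length (x ++ w ++ y)              ≡⟨ cong (origin ⊕_) (length-++ x) ⟩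
        origin ⊕ (length x + length (w ++ y))      ≡⟨ ⊕-⊕ origin (length x) (length (w ++ y)) ⟨
        i ⊕ length (w ++ y)                        ≡⟨ cong (i ⊕_) (length-++ w) ⟩
        i ⊕ (length w + length y)                  ≡⟨ ⊕-⊕ i (length w) (length y) ⟨
        i ⊕ length w ⊕ length y                    ≡⟨ cong (_⊕ length y) (∣⇒⊕≡ i d∣w) ⟩
        r                                          ∎
        where open ≡-Reasoning

      context : ∀ w → d ∣ length w →
                L (x ++ w ++ y) ⇔ K r (mark origin x ++ mark i w ++ mark i y)
      context w d∣w = subst (λ z → L (x ++ w ++ y) ⇔ K r z)
        (trans (mark-++ origin x (w ++ y)) (cong (mark origin x ++_) (mark-∣ i w y d∣w)))
        (subst (λ z → L (x ++ w ++ y) ⇔ K z (mark origin (x ++ w ++ y))) (residue w d∣w)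
          (marked (x ++ w ++ y)))

-- Recognizers of marked languages from locality.

module _ (M : Mon) where
  private module M = Monoid M

  -- The universal property of the free monoid.
  extend : (Fin k → M.Carrier) → Morphism k M
  extend {k} f = record
    { apply          = value
    ; isHomomorphism = record
      { isMagmaHomomorphism = record
        { isRelHomomorphism = record { cong = λ e → M.reflexive (cong value e) } ; homo = value-++ }
      ; ε-homo = M.refl }
    }
    where
    value : Word k → M.Carrier
    value []      = M.ε
    value (a ∷ u) = f a M.∙ value u

    value-++ : ∀ u v → value (u ++ v) M.≈ value u M.∙ value v
    value-++ []      v = M.sym (M.identityˡ (value v))
    value-++ (a ∷ u) v = M.trans (M.∙-congˡ (value-++ u v)) (M.sym (M.assoc (f a) (value u) (value v)))

module _ (V : Variety ℓ) {L : Language n} (L? : Unary.Decidable L) (s : ℕ) .{{_ : NonZero s}}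
         (stable : Stable (syntacticMorphism L) s) where
  private
    module Syn = Monoid (syntacticMonoid L)
    N = stableMonoid (syntacticMorphism L) s
  open StableExponent L L? s stable

  lengthCategory : Category
  lengthCategory = record
    { Obj           = Fin s
    ; _⇒_           = λ e f → Σ[ u ∈ Word n ] e ⊕ length u ≡ f
    ; _≈_           = λ x y → SyntacticCongruence L (proj₁ x) (proj₁ y)
    ; isEquivalence = On.isEquivalence proj₁ Syn.isEquivalence
    ; 1ᶜ            = λ e → [] , ⊕-identityʳ e
    ; _∙_           = λ { {e} (u , p) (v , q) → u ++ v , trans (cong (e ⊕_) (length-++ u))
                            (trans (sym (⊕-⊕ e (length u) (length v))) (trans (cong (_⊕ length v) p) q)) }
    ; ∙-cong        = λ { {x = u , _} {u′ , _} {v , _} {v′ , _} → Syn.∙-cong {u} {u′} {v} {v′} }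
    ; assoc         = λ { (u , _) (v , _) (w , _) → Syn.assoc u v w }
    ; identityˡ     = λ { (u , _) → Syn.identityˡ u }
    ; identityʳ     = λ { (u , _) → Syn.identityʳ u }
    }

  open Category lengthCategory using (homSetoid; localMonoid)

  -- Shortening a word by multiples of `s` leaves the end object of its arrow unchanged.
  homSetoid-finite : ∀ e f → Finite (homSetoid e f)
  homSetoid-finite e f = bounded⇒finite (λ u → e ⊕ length u ≟F f) Syn.isEquivalence _≋?_ (s + s)
    λ u p → let v , c , v< , |u| , v≋u = bounded u in
      v , v< , trans (sym (⊕-period e (length v) c)) (trans (cong (e ⊕_) (sym |u|)) p) ,
      Syn.sym {v} {u} v≋u

  -- A loop has length divisible by `s`, so its class lies in the stable monoid. Loops and stable
  -- elements are compared by the same congruence, so each local monoid embeds in `N`.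
  lengthCategory∈ℓ : Variety.member V N → _∈ℓ V lengthCategory
  lengthCategory∈ℓ N∈V =
    ((s , Identity.inverse (setoid (Fin s))) , homSetoid-finite) ,
    λ e → quotient-member (localMonoid e) V {g = id} (homSetoid-finite e e)
      (record
        { isMagmaHomomorphism = record
          { isRelHomomorphism = record { cong = id }
          ; homo              = λ x y → Syn.refl {proj₁ x ++ proj₁ y} }
        ; ε-homo = Syn.refl {[]} })
      (λ y → y , Syn.refl {proj₁ y})
      (record
        { target∈V = N∈V
        ; map      = λ { (u , p) → toStable u (⊕≡⇒∣ e (length u) p) }
        ; map-hom  = record
          { isMagmaHomomorphism = record
            { isRelHomomorphism = record { cong = id }
            ; homo              = λ x y → Syn.refl {proj₁ x ++ proj₁ y} }
          ; ε-homo = Syn.refl {[]} }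
        })
      id

  module _ {M : Mon} (M∈V : Variety.member V M)
           (division : CategoryDivision lengthCategory (oneObject M)) where
    private
      module M = Monoid M
      module I = Inverse (proj₂ (Variety.finite V M∈V))
      _≟M_ = finite⇒decidable M.setoid (Variety.finite V M∈V)
    open CategoryDivision division

    private
      letterValue : Fin n × Fin s → M.Carrier
      letterValue (a , e) = proj₁ (τ-total {e} (a ∷ [] , refl))

      ψ : Morphism (n * s) M
      ψ = extend M (letterValue ∘ remQuot s)

    open IsMonoidHomomorphism (isHomomorphism ψ) using (homo)

    -- A word is the composite of its one-letter arrows, so by `τ-∙` it is related to the product of
    -- the values chosen for them.
    τ-mark : ∀ e u {f} (p : e ⊕ length u ≡ f) → τ {e} {f} (u , p) (apply ψ (mark e u))
    τ-mark e []      refl =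
      -- The identity ends at `e`, the empty word at `e ⊕ 0`. Quantifying over `p` is harmless
      -- because equality of arrows ignores that proof.
      subst (λ f → ∀ p → τ {e} {f} ([] , p) M.ε) (sym (⊕-identityʳ e))
        (λ p → τ-resp-≈ (Syn.refl {[]}) M.refl (τ-1 e)) refl
    τ-mark e (a ∷ u) refl = τ-resp-≈ (Syn.refl {a ∷ u})
      (M.∙-congʳ (M.reflexive (cong letterValue (sym (remQuot-combine a e)))))
      (τ-∙ (proj₂ (τ-total {e} (a ∷ [] , refl))) (τ-mark (e ⊕ 1) u (⊕-⊕ e 1 (length u))))

    -- Equal residues make the two words coterminal arrows, and by `τ-mark` they are related to a
    -- common value. Disjointness then refutes their being distinct; decidability of the congruence
    -- removes the double negation.
    separates : ∀ u v → origin {s} ⊕ length u ≡ origin ⊕ length v →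
                apply ψ (mark origin u) M.≈ apply ψ (mark origin v) → SyntacticCongruence L u v
    separates u v p e = decidable-stable (u ≋? v) λ u≋̸v →
      τ-disjoint {x = u , p} {v , refl} u≋̸v (τ-resp-≈ (Syn.refl {u}) e (τ-mark origin u p))
        (τ-mark origin v refl)

    private
      -- Residue of the length and value in `M` form one finite right-compatible invariant, so that
      -- `boundedRepresentatives` applies.
      f : Word n → Fin (s * proj₁ (Variety.finite V M∈V))
      f u = combine (origin ⊕ length u) (I.to (apply ψ (mark origin u)))

      f-injective : ∀ u v → f u ≡ f v → origin {s} ⊕ length u ≡ origin ⊕ length v ×
                    apply ψ (mark origin u) M.≈ apply ψ (mark origin v)
      f-injective u v e with combine-injective (origin ⊕ length u) _ (origin ⊕ length v) _ e
      ... | p , q = p , Injection.injective (Inverse⇒Injection (proj₂ (Variety.finite V M∈V))) q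

      f-++ : ∀ u w → f (u ++ w) ≡ combine (origin ⊕ length u ⊕ length w)
                       (I.to (apply ψ (mark origin u) M.∙ apply ψ (mark (origin ⊕ length u) w)))
      f-++ u w = cong₂ combine
        (trans (cong (origin ⊕_) (length-++ u)) (sym (⊕-⊕ origin (length u) (length w))))
        (I.to-cong (M.trans (M.reflexive (cong (apply ψ) (mark-++ origin u w))) (homo (mark origin u) _)))

      f-cong : ∀ {u v} → f u ≡ f v → ∀ w → f (u ++ w) ≡ f (v ++ w)
      f-cong {u} {v} e w with f-injective u v e
      ... | p , q = trans (f-++ u w) (trans
        (cong₂ combine (cong (_⊕ length w) p)
          (I.to-cong (M.∙-cong q (M.reflexive (cong (λ z → apply ψ (mark z w)) p)))))
        (sym (f-++ v w)))

      b = proj₁ (boundedRepresentatives f (λ {u} {v} → f-cong {u} {v}))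

      -- The bound on the witness makes acceptance decidable. It loses nothing, since every word
      -- shares its residue and value with a word shorter than `b`.
      Accept : Fin s → M.Carrier → Set
      Accept i y = ∃[ v ] length v < b × origin ⊕ length v ≡ i × apply ψ (mark origin v) M.≈ y × L v

    markedLanguage : Fin s → Language (n * s)
    markedLanguage i w = Accept i (apply ψ w)

    markedLanguage-recognized : ∀ i → Recognizes M (markedLanguage i)
    markedLanguage-recognized i = record
      { morphism = ψ
      ; accept   = Accept i
      ; accept?  = λ y → ∃<? (λ v → (origin ⊕ length v ≟F i) ×-dec
                                    (apply ψ (mark origin v) ≟M y) ×-dec L? v) b
      ; accept-≈ = λ { y≈z (v , v< , p , e , v∈L) → v , v< , p , M.trans e y≈z , v∈L }
      ; preimage = λ w → ⇔-id _
      }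

    markedLanguage-marked : MarkedBy s markedLanguage L
    markedLanguage-marked u = mk⇔ represent
      (λ (v , _ , p , e , v∈L) → ≋-resp L v u (separates v u p e) v∈L)
      where
      represent : L u → Accept (origin ⊕ length u) (apply ψ (mark origin u))
      represent u∈L =
        let v , v< , e = proj₂ (boundedRepresentatives f (λ {u} {v} → f-cong {u} {v})) u
            p , q      = f-injective v u e
        in v , v< , p , q , ≋-resp L u v (Syn.sym {v} {u} (separates v u p q)) u∈L

-- The equivalences and the transfer of decidability.

module _ {σ : Signature} (F : Fragment σ ℓ₁) (V : Variety ℓ₂) (F≈V : EquivalentTo F V) where

  definable⇒stable-member : {L : Language n} → Unary.Decidable L → ∀ s .{{_ : NonZero s}} →
    Stable (syntacticMorphism L) s → ⟦_,_⟧ F MOD L →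
    Variety.member V (stableMonoid (syntacticMorphism L) s)
  definable⇒stable-member L? s stable definable =
    let c , nz , markings  = definable⇒markedBy F definable
        -- `c * s` is a multiple both of the modulus bounding the formula and of `s`.
        instance d≢0       = m*n≢0 c s {{nz}}
        K , K∈F , marked  = markings (c * s) (m∣m*n s)
    in markedBy⇒stable-member V L? s stable (c * s) (n∣m*n c) K (λ r → to (F≈V (K r)) (K∈F r)) marked

  stable-member⇒definable : Local V → {L : Language n} → Unary.Decidable L → ∀ s .{{_ : NonZero s}} →
    Stable (syntacticMorphism L) s → Variety.member V (stableMonoid (syntacticMorphism L) s) →
    ⟦_,_⟧ F (MOD^ s) L
  stable-member⇒definable local L? s stable N∈V =
    let _ , M , M∈V , division =
          from (local (lengthCategory V L? s stable)) (lengthCategory∈ℓ V L? s stable N∈V)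
    in markedBy⇒definable F s
         (λ i → from (F≈V _) (M , M∈V , markedLanguage-recognized V L? s stable M∈V division i))
         (markedLanguage-marked V L? s stable M∈V division)

  MOD^-definable⇒MOD-definable : {L : Language n} → ∀ s .{{_ : NonZero s}} →
                                 ⟦_,_⟧ F (MOD^ s) L → ⟦_,_⟧ F MOD L
  MOD^-definable⇒MOD-definable s (φ , φ∈ , defines) =
    φ , enrichment-mono (MOD^⇒MOD s) φ∈ , defines

  -- `N` recognizes its own fibres. Conversely, if monoids of `V` recognize all fibres, their
  -- product separates words of different values, and `N`, being the image of the evaluation,
  -- divides it.
  member? : DecidableClass ⟦ F ⟧ → ∀ {N} → FiniteMonoid N → Dec (Variety.member V N)
  member? F? {N} finite@(k , fin) = map′ definable⇒member member⇒definable
    (Fin.all? (λ i → F? (fibre i) (N , finite , recognizes i)))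
    where
    module N = Monoid N
    module I = Inverse fin
    open Injection (Inverse⇒Injection fin) using (injective)

    evaluation : Morphism k N
    evaluation = extend N I.from

    fibre : Fin k → Language k
    fibre i w = I.to (apply evaluation w) ≡ i

    recognizes : ∀ i → Recognizes N (fibre i)
    recognizes i = record
      { morphism = evaluation
      ; accept   = λ y → I.to y ≡ i
      ; accept?  = λ y → I.to y ≟F i
      ; accept-≈ = λ y≈z e → trans (sym (I.to-cong y≈z)) e
      ; preimage = λ w → ⇔-id _
      }

    member⇒definable : Variety.member V N → ∀ i → ⟦ F ⟧ (fibre i)
    member⇒definable N∈V i = from (F≈V (fibre i)) (N , N∈V , recognizes i)

    definable⇒member : (∀ i → ⟦ F ⟧ (fibre i)) → Variety.member V N
    definable⇒member definable = quotient-member (++-monoid (Fin k)) V finite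
      (isHomomorphism evaluation)
      (λ y → I.to y ∷ [] , N.trans (N.identityʳ _) (I.strictlyInverseʳ y))
      (proj₁ H)
      -- The fibre over the value of `u` contains `u`; words with equal joint image lie in the same
      -- fibres, so it contains `v` too.
      (λ {u} {v} e → let i = I.to (apply evaluation u) in
        injective (sym (to (recognized-resp (R i) {u} {v} (proj₂ H e i)) refl)))
      where
      recognized = λ i → to (F≈V (fibre i)) (definable i)
      R          = λ i → proj₂ (proj₂ (recognized i))

      H = joint (++-monoid (Fin k)) V k (λ i → record
        { target∈V = proj₁ (proj₂ (recognized i))
        ; map-hom  = isHomomorphism (Recognizes.morphism (R i))
        })

theorem6 :
    ∀ {ℓ₁ ℓ₂ : Level} {σ : Signature} (F : Fragment σ ℓ₁) (V : Variety ℓ₂) →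
    EquivalentTo F V → Local V →
    (∀ {n : ℕ} (L : Language n) → Regular L →
     ∀ (s : ℕ) .{{_ : NonZero s}} → IsStabilityIndex (syntacticMorphism L) s →
       (⟦_,_⟧ F MOD L ⇔ ⟦_,_⟧ F (MOD^ s) L)
     × (⟦_,_⟧ F (MOD^ s) L ⇔ Variety.member V (stableMonoid (syntacticMorphism L) s)))
    × (DecidableClass ⟦ F ⟧ → DecidableClass (⟦_,_⟧ F MOD))
theorem6 F V F≈V local = equivalences , decidability
  where
  equivalences : ∀ {n} (L : Language n) → Regular L →
    ∀ s .{{_ : NonZero s}} → IsStabilityIndex (syntacticMorphism L) s →
      (⟦_,_⟧ F MOD L ⇔ ⟦_,_⟧ F (MOD^ s) L)
    × (⟦_,_⟧ F (MOD^ s) L ⇔ Variety.member V (stableMonoid (syntacticMorphism L) s))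
  equivalences L regular s index =
    mk⇔ (2⇐3 ∘ 1⇒3) 2⇒1 , mk⇔ (1⇒3 ∘ 2⇒1) 2⇐3
    where
    N      = stableMonoid (syntacticMorphism L) s
    L?     = regular⇒decidable regular
    stable = IsStabilityIndex.stable index

    1⇒3 : ⟦_,_⟧ F MOD L → Variety.member V N
    1⇒3 = definable⇒stable-member F V F≈V L? s stable

    2⇐3 : Variety.member V N → ⟦_,_⟧ F (MOD^ s) L
    2⇐3 = stable-member⇒definable F V F≈V local L? s stable

    2⇒1 : ⟦_,_⟧ F (MOD^ s) L → ⟦_,_⟧ F MOD L
    2⇒1 = MOD^-definable⇒MOD-definable F V F≈V s

  decidability : DecidableClass ⟦ F ⟧ → DecidableClass (⟦_,_⟧ F MOD)
  decidability F? L regular =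
    let L?              = regular⇒decidable regular
        s , nz , stable = regular⇒stable regular
    -- The monoid passed to `member?` is the stable monoid for the exponent found above; both
    -- implications hold for that exponent.
    in map′
      (MOD^-definable⇒MOD-definable F V F≈V s {{nz}} ∘
       stable-member⇒definable F V F≈V local L? s {{nz}} stable)
      (definable⇒stable-member F V F≈V L? s {{nz}} stable)
      (member? F V F≈V F? (StableExponent.stableMonoid-finite L L? s {{nz}} stable))
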